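{- Let $\Gamma$ be a finite, undirected, simple, connected graph, let $G \le \operatorname{Aut}(\Gamma)$, and suppose $\Gamma$ is $G$-arc-transitive and contains a $G$-permutable $m$-matching. Then the degree of $\Gamma$ is at least $m$, unless $m = 3$ and $\Gamma$ is the cycle $C_{3k}$ for some $k \ge 2$.
   Context: A matching is a set of edges no two of which share a vertex. For $G \le \operatorname{Aut}(\Gamma)$, a matching $\mathcal{M}$ with $m$ edges is a $G$-permutable $m$-matching if the setwise stabilizer $G_{\mathcal{M}}$ of $\mathcal{M}$ in $G$ induces the full symmetric group $S_m$ on the set of $m$ edges of $\mathcal{M}$. $\Gamma$ is $G$-arc-transitive if $G$ is transitive on ordered pairs of adjacent vertices. -}

module Defs where

open import Data.Nat using (ℕ; suc; _≤_; _*_; _+_)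
open import Data.Nat.DivMod using (_%_)
open import Data.Fin using (Fin; toℕ)
open import Data.Fin.Permutation using (Permutation′; _⟨$⟩ʳ_; id; flip; _∘ₚ_)
open import Data.Bool using (Bool; true; false; T)
open import Data.List using (List; length; filter; allFin)
open import Data.Product using (Σ; ∃; ∃-syntax; _×_; _,_)
open import Data.Sum using (_⊎_)
open import Relation.Nullary using (¬_)
open import Relation.Nullary.Decidable using (T?)
open import Relation.Binary.PropositionalEquality using (_≡_)
open import Function.Bundles using (_↔_; Inverse)

record Graph : Set where
  field
    n     : ℕ
    adj   : Fin n → Fin n → Bool
    sym   : ∀ u v → adj u v ≡ adj v u
    irrefl : ∀ v → adj v v ≡ false
open Graph public

module _ (Γ : Graph) where
  private
    V = Fin (n Γ)

  Adj : V → V → Set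
  Adj u v = T (adj Γ u v)

  degree : V → ℕ
  degree v = length (filter (λ w → T? (adj Γ v w)) (allFin (n Γ)))

  data Reach : V → V → Set where
    here : ∀ {v} → Reach v v
    step : ∀ {u w v} → Adj u w → Reach w v → Reach u v

  Connected : Set
  Connected = ∀ u v → Reach u v

  IsAut : Permutation′ (n Γ) → Set
  IsAut g = ∀ u v → adj Γ (g ⟨$⟩ʳ u) (g ⟨$⟩ʳ v) ≡ adj Γ u v

  record IsAutSubgroup (G : Permutation′ (n Γ) → Set) : Set where
    field
      aut   : ∀ g → G g → IsAut g
      hasId : G id
      comp  : ∀ g h → G g → G h → G (g ∘ₚ h)
      inv   : ∀ g → G g → G (flip g)

  ArcTransitive : (Permutation′ (n Γ) → Set) → Set
  ArcTransitive G = ∀ u v u' v' → Adj u v → Adj u' v' →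
    ∃[ g ] (G g × (g ⟨$⟩ʳ u ≡ u') × (g ⟨$⟩ʳ v ≡ v'))

  record Matching (m : ℕ) : Set where
    field
      fst snd  : Fin m → V
      isEdge   : ∀ i → Adj (fst i) (snd i)
      disjoint : ∀ i j → ¬ (i ≡ j) →
        ¬ (fst i ≡ fst j) × ¬ (fst i ≡ snd j) × ¬ (snd i ≡ fst j) × ¬ (snd i ≡ snd j)
  open Matching public

  MapsEdge : ∀ {m} → Matching m → Permutation′ (n Γ) → Fin m → Fin m → Set
  MapsEdge M g i j =
    ((g ⟨$⟩ʳ fst M i ≡ fst M j) × (g ⟨$⟩ʳ snd M i ≡ snd M j)) ⊎
    ((g ⟨$⟩ʳ fst M i ≡ snd M j) × (g ⟨$⟩ʳ snd M i ≡ fst M j))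

  -- G-permutable m-matching: the setwise stabiliser G_M induces the full
  -- symmetric group S_m on the m edges, i.e. every permutation σ of the edges
  -- is induced by some g ∈ G (such g automatically stabilises M setwise).
  Permutable : ∀ {m} → (Permutation′ (n Γ) → Set) → Matching m → Set
  Permutable {m} G M = ∀ (σ : Permutation′ m) →
    ∃[ g ] (G g × (∀ i → MapsEdge M g i (σ ⟨$⟩ʳ i)))

CycleAdj : (N : ℕ) → Fin N → Fin N → Set
CycleAdj (suc N) i j =
  toℕ j ≡ suc (toℕ i) % suc N ⊎ toℕ i ≡ suc (toℕ j) % suc N

IsCycle : Graph → ℕ → Set
IsCycle Γ N = Σ (Fin (n Γ) ↔ Fin N) λ φ →
  ∀ u v → (Adj Γ u v → CycleAdj N (Inverse.to φ u) (Inverse.to φ v))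
        × (CycleAdj N (Inverse.to φ u) (Inverse.to φ v) → Adj Γ u v)

{-# OPTIONS --safe #-}
-- Suppose the degree d is less than m. Stabilising one edge e of the matching, fourth powers give
-- elements that fix both ends of e and induce any prescribed 3-cycle on the other m - 1 edges. If X is
-- a set of fixed vertices containing an arc (x , y), the pointwise stabiliser of X permutes the d - 1
-- remaining neighbours of y, and X is enlarged by them; once X is everything, no 3-cycle can survive.
--
-- * d ≤ 3: on at most two points a square is trivial, and squaring does not kill a 3-cycle.
-- * m ≥ 6: the alternating group of degree m - 1 has no nontrivial action on fewer than m - 1 points.
-- * m = 5, d = 4: the arc stabiliser would involve the alternating group of degree 4. Write N u for the
--   kernel of the vertex stabiliser G_u on the neighbours of u, and O_p for the largest normal p-subgroup
--   of N u. If O_p (N u) always fixes the neighbours of the neighbours of u, then O_p (N u) ≤ O_p (N v) for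
--   adjacent u, v, so it is trivial. This holds for p = 2 since the symmetric group of degree 3 has no
--   normal involution. If it fails for p = 3, an element of O_3 (N z) permutes three neighbours of y ~ z
--   cyclically, so every element of N y has the same sign on the neighbourhoods of all neighbours of y, and
--   the even elements of N u ∩ N v have 3-power order. If it holds for p = 3 as well, the pointwise
--   stabilisers of balls are trivial by descending induction on the radius. In both cases a commutator
--   inducing a double transposition yields a contradiction.
-- * m = 3, d = 2: the graph is a cycle, and the 3-cycle on the edges is a rotation of order 3.
module Submission where

open import Data.Bool using (T)
open import Data.Empty using (⊥; ⊥-elim)
open import Data.Fin using (Fin; combine; fromℕ<; punchOut; remQuot; suc; toℕ; zero)
open import Data.Fin.Patterns
open import Data.Fin.Permutation using (Permutation′; _∘ₚ_; _⟨$⟩ʳ_; _⟨$⟩ˡ_; flip; id; inverseʳ; inverseˡ; transpose)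
open import Data.Fin.Properties using (<⇒≢; _≟_; all?; any?; combine-injectiveʳ; combine-injectiveˡ; combine-remQuot; injective⇒≤; pigeonhole; punchOut-injective; suc-injective; toℕ-fromℕ<; toℕ-injective; toℕ<n; ¬∀⟶∃¬)
open import Data.List using (List; []; _∷_; allFin; filter; length; lookup)
open import Data.List.Membership.Propositional using (_∈_)
open import Data.List.Membership.Propositional.Properties using (∈-allFin; ∈-filter⁺; ∈-filter⁻; ∈-lookup)
open import Data.List.Membership.Setoid.Properties using (index-injective)
open import Data.List.Properties using (filter-notAll)
open import Data.List.Relation.Unary.All as All using (All; []; _∷_)
open import Data.List.Relation.Unary.All.Properties using (¬Any⇒All¬)
open import Data.List.Relation.Unary.AllPairs using ([]; _∷_)
open import Data.List.Relation.Unary.Any as Any using (Any; here; index; there)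
open import Data.List.Relation.Unary.Any.Properties using (lookup-index)
open import Data.List.Relation.Unary.Unique.Propositional using (Unique)
open import Data.List.Relation.Unary.Unique.Propositional.Properties using (allFin⁺; filter⁺)
open import Data.Nat using (>-nonZero; _!; _*_; _+_; _<_; _^_; _∸_; _≤?_; _≤_; _⊔_; suc; s≤s; z<s; zero; z≤n; ℕ)
open import Data.Nat.DivMod using (_%_; _/_; m%n<n; m≡m%n+[m/n]*n)
open import Data.Nat.Properties using (*-assoc; *-comm; *-distribˡ-∸; *-mono-≤; *-monoʳ-<; *-monoˡ-<; +-assoc; +-comm; +-identityʳ; +-suc; 1+n≰n; <-irrefl; <-≤-trans; <⇒≤; ^-distribˡ-+-*; m+n∸n≡m; m+n≡0⇒m≡0; m≤m+n; m≤m⊔n; m≤n⇒m<n∨m≡n; m≤n⇒∃[o]m+o≡n; m≤n⊔m; n≤1+n; n≮0; ≤-<-trans; ≤-antisym; ≤-pred; ≤-refl; ≤-reflexive; ≤-trans; ≰⇒>) renaming (suc-injective to ℕ-suc-injective)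
open import Data.Nat.Solver using (module +-*-Solver)
open import Data.Product using (_,_; _×_; proj₁; proj₂; Σ; Σ-syntax; ∃-syntax)
open import Data.Sum using ([_,_]′; _⊎_; inj₁; inj₂)
open import Data.Unit using (tt)
open import Defs hiding (sym)
open import Function using (case_of_; mk↔ₛ′)
open import Relation.Binary.PropositionalEquality using (_≡_; _≢_; cong; module ≡-Reasoning; refl; setoid; subst; sym; trans)
open import Relation.Nullary using (Dec; no; yes; ¬?; ¬_)
open import Relation.Nullary.Decidable using (T?; _→-dec_; _⊎-dec_; dec-false; dec-true; decidable-stable; toWitness)
import Data.List.Membership.DecPropositional as DM

-- Groups, actions, normal closures and p-radicals.

record RawGrp : Set₁ where
  infixl 7 _∙_
  infix 8 _⁻¹
  field
    E   : Set
    _∙_ : E → E → E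
    ε   : E
    _⁻¹ : E → E

  pow : E → ℕ → E
  pow g zero    = ε
  pow g (suc k) = g ∙ pow g k

  conj : E → E → E
  conj g h = g ∙ h ∙ g ⁻¹

  comm : E → E → E
  comm g h = conj g h ∙ h ⁻¹

  record Closed (X : E → Set) : Set where
    field
      has-ε  : X ε
      has-∙  : ∀ {g h} → X g → X h → X (g ∙ h)
      has-⁻¹ : ∀ {g} → X g → X (g ⁻¹)

    has-pow : ∀ {g} k → X g → X (pow g k)
    has-pow zero    x = has-ε
    has-pow (suc k) x = has-∙ x (has-pow k x)

    has-conj : ∀ {g h} → X g → X h → X (conj g h)
    has-conj x y = has-∙ (has-∙ x y) (has-⁻¹ x)

    has-comm : ∀ {g h} → X g → X h → X (comm g h)
    has-comm x y = has-∙ (has-conj x y) (has-⁻¹ y)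

-- The group laws are never needed: a group is only ever seen through its actions.
record Action (𝒢 : RawGrp) (A : Set) : Set where
  open RawGrp 𝒢
  field
    act     : E → A → A
    act-∙   : ∀ g h x → act (g ∙ h) x ≡ act g (act h x)
    act-ε   : ∀ x → act ε x ≡ x
    act-⁻¹ˡ : ∀ g x → act (g ⁻¹) (act g x) ≡ x
    act-⁻¹ʳ : ∀ g x → act g (act (g ⁻¹) x) ≡ x

module ActionProps {𝒢 : RawGrp} {A : Set} (α : Action 𝒢 A) where
  open RawGrp 𝒢 public
  open Action α public
  open ≡-Reasoning

  act-inj : ∀ g {x y} → act g x ≡ act g y → x ≡ y
  act-inj g {x} {y} e = trans (sym (act-⁻¹ˡ g x)) (trans (cong (act (g ⁻¹)) e) (act-⁻¹ˡ g y))

  act-⁻¹ : ∀ g {x y} → act g x ≡ y → act (g ⁻¹) y ≡ x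
  act-⁻¹ g {x} e = trans (cong (act (g ⁻¹)) (sym e)) (act-⁻¹ˡ g x)

  fix-∙ : ∀ g h {x} → act g x ≡ x → act h x ≡ x → act (g ∙ h) x ≡ x
  fix-∙ g h {x} p q = trans (act-∙ g h x) (trans (cong (act g) q) p)

  fix-pow : ∀ g k {x} → act g x ≡ x → act (pow g k) x ≡ x
  fix-pow g zero    {x} p = act-ε x
  fix-pow g (suc k) {x} p = fix-∙ g (pow g k) p (fix-pow g k p)

  pow-+ : ∀ g a b x → act (pow g (a + b)) x ≡ act (pow g a) (act (pow g b) x)
  pow-+ g zero    b x = sym (act-ε _)
  pow-+ g (suc a) b x = begin
    act (g ∙ pow g (a + b)) x             ≡⟨ act-∙ g _ x ⟩
    act g (act (pow g (a + b)) x)         ≡⟨ cong (act g) (pow-+ g a b x) ⟩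
    act g (act (pow g a) (act (pow g b) x)) ≡⟨ act-∙ g _ _ ⟨
    act (g ∙ pow g a) (act (pow g b) x)   ∎

  pow-* : ∀ g a b x → act (pow (pow g a) b) x ≡ act (pow g (b * a)) x
  pow-* g a zero    x = refl
  pow-* g a (suc b) x = begin
    act (pow g a ∙ pow (pow g a) b) x       ≡⟨ act-∙ (pow g a) _ x ⟩
    act (pow g a) (act (pow (pow g a) b) x) ≡⟨ cong (act (pow g a)) (pow-* g a b x) ⟩
    act (pow g a) (act (pow g (b * a)) x)   ≡⟨ pow-+ g a (b * a) x ⟨
    act (pow g (a + b * a)) x               ∎

  pow1 : ∀ g x → act (pow g 1) x ≡ act g x
  pow1 g x = trans (act-∙ g ε x) (cong (act g) (act-ε x))

  pow2 : ∀ g x → act (pow g 2) x ≡ act g (act g x)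
  pow2 g x = trans (act-∙ g _ x) (cong (act g) (pow1 g x))

  pow3 : ∀ g x → act (pow g 3) x ≡ act g (act g (act g x))
  pow3 g x = trans (act-∙ g _ x) (cong (act g) (pow2 g x))

  fix-mul : ∀ g a b {x} → act (pow g a) x ≡ x → act (pow g (b * a)) x ≡ x
  fix-mul g a b {x} p = trans (sym (pow-* g a b x)) (fix-pow (pow g a) b p)

  infix 4 _≈_
  _≈_ : E → E → Set
  g ≈ h = ∀ x → act g x ≡ act h x

  Trivial : E → Set
  Trivial g = ∀ x → act g x ≡ x

  conj-act : ∀ g h x → act (conj g h) (act g x) ≡ act g (act h x)
  conj-act g h x = begin
    act (g ∙ h ∙ g ⁻¹) (act g x)        ≡⟨ act-∙ (g ∙ h) _ _ ⟩
    act (g ∙ h) (act (g ⁻¹) (act g x))  ≡⟨ cong (act (g ∙ h)) (act-⁻¹ˡ g x) ⟩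
    act (g ∙ h) x                       ≡⟨ act-∙ g h x ⟩
    act g (act h x)                     ∎

  pow-conj : ∀ g h k x → act (pow (conj g h) k) (act g x) ≡ act g (act (pow h k) x)
  pow-conj g h zero    x = trans (act-ε _) (cong (act g) (sym (act-ε x)))
  pow-conj g h (suc k) x = begin
    act (conj g h ∙ pow (conj g h) k) (act g x)    ≡⟨ act-∙ (conj g h) _ _ ⟩
    act (conj g h) (act (pow (conj g h) k) (act g x)) ≡⟨ cong (act (conj g h)) (pow-conj g h k x) ⟩
    act (conj g h) (act g (act (pow h k) x))       ≡⟨ conj-act g h _ ⟩
    act g (act h (act (pow h k) x))                ≡⟨ cong (act g) (act-∙ h _ x) ⟨
    act g (act (h ∙ pow h k) x)                    ∎

  conj-intro : ∀ g h {k : E} → (∀ x → act k (act g x) ≡ act g (act h x)) → conj g h ≈ k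
  conj-intro g h {k} p y = begin
    act (conj g h) y                      ≡⟨ cong (act (conj g h)) (act-⁻¹ʳ g y) ⟨
    act (conj g h) (act g (act (g ⁻¹) y)) ≡⟨ conj-act g h _ ⟩
    act g (act h (act (g ⁻¹) y))          ≡⟨ p _ ⟨
    act k (act g (act (g ⁻¹) y))          ≡⟨ cong (act k) (act-⁻¹ʳ g y) ⟩
    act k y                               ∎

  pow-cong : ∀ {g h} → g ≈ h → ∀ k → pow g k ≈ pow h k
  pow-cong p zero    x = refl
  pow-cong {g} {h} p (suc k) x = trans (act-∙ g _ x)
    (trans (p _) (trans (cong (act h) (pow-cong p k x)) (sym (act-∙ h _ x))))

  -- The order is that of the induced permutation, since elements of `E` are compared only through
  -- `_≈_`.
  PElement : ℕ → E → Set
  PElement p g = ∃[ k ] Trivial (pow g (p ^ k))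

  PElement-≈ : ∀ {p g h} → g ≈ h → PElement p g → PElement p h
  PElement-≈ {p} e (k , t) = k , λ x → trans (sym (pow-cong e (p ^ k) x)) (t x)

  PElement-conj : ∀ {p} g {h} → PElement p h → PElement p (conj g h)
  PElement-conj {p} g {h} (k , t) = k , λ x → begin
    act (pow (conj g h) (p ^ k)) x                      ≡⟨ cong (act (pow (conj g h) (p ^ k))) (act-⁻¹ʳ g x) ⟨
    act (pow (conj g h) (p ^ k)) (act g (act (g ⁻¹) x)) ≡⟨ pow-conj g h (p ^ k) _ ⟩
    act g (act (pow h (p ^ k)) (act (g ⁻¹) x))          ≡⟨ cong (act g) (t _) ⟩
    act g (act (g ⁻¹) x)                                ≡⟨ act-⁻¹ʳ g x ⟩
    x                                                   ∎

  -- `X` supplies the conjugating elements. No constructor gives inverses: for elements of finite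
  -- order they are powers, up to `resp`.
  data NormalClosure (X : E → Set) (x : E) : E → Set where
    gen  : ∀ {g} → X g → NormalClosure X x (conj g x)
    one  : NormalClosure X x ε
    mul  : ∀ {a b} → NormalClosure X x a → NormalClosure X x b → NormalClosure X x (a ∙ b)
    resp : ∀ {a b} → a ≈ b → NormalClosure X x a → NormalClosure X x b

  conj-conj : ∀ g h x → conj g (conj h x) ≈ conj (g ∙ h) x
  conj-conj g h x = conj-intro g (conj h x) λ y → begin
    act (conj (g ∙ h) x) (act g y)
      ≡⟨ cong (λ z → act (conj (g ∙ h) x) (act g z)) (act-⁻¹ʳ h y) ⟨
    act (conj (g ∙ h) x) (act g (act h (act (h ⁻¹) y)))
      ≡⟨ cong (act (conj (g ∙ h) x)) (act-∙ g h _) ⟨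
    act (conj (g ∙ h) x) (act (g ∙ h) (act (h ⁻¹) y))
      ≡⟨ conj-act (g ∙ h) x _ ⟩
    act (g ∙ h) (act x (act (h ⁻¹) y))
      ≡⟨ act-∙ g h _ ⟩
    act g (act h (act x (act (h ⁻¹) y)))
      ≡⟨ cong (act g) (conj-act h x _) ⟨
    act g (act (conj h x) (act h (act (h ⁻¹) y)))
      ≡⟨ cong (λ z → act g (act (conj h x) z)) (act-⁻¹ʳ h y) ⟩
    act g (act (conj h x) y) ∎

  conj-∙ : ∀ g a b → conj g (a ∙ b) ≈ conj g a ∙ conj g b
  conj-∙ g a b = conj-intro g (a ∙ b) λ y → begin
    act (conj g a ∙ conj g b) (act g y)      ≡⟨ act-∙ (conj g a) _ _ ⟩
    act (conj g a) (act (conj g b) (act g y)) ≡⟨ cong (act (conj g a)) (conj-act g b y) ⟩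
    act (conj g a) (act g (act b y))          ≡⟨ conj-act g a _ ⟩
    act g (act a (act b y))                   ≡⟨ cong (act g) (act-∙ a b y) ⟨
    act g (act (a ∙ b) y)                     ∎

  conj-ε : ∀ g → conj g ε ≈ ε
  conj-ε g = conj-intro g ε λ y → trans (act-ε _) (cong (act g) (sym (act-ε y)))

  conj-≈ : ∀ g {a b} → a ≈ b → conj g a ≈ conj g b
  conj-≈ g {a} {b} e = conj-intro g a λ y → trans (conj-act g b y) (cong (act g) (sym (e y)))

  ε-conj : ∀ x → conj ε x ≈ x
  ε-conj x = conj-intro ε x λ y → trans (cong (act x) (act-ε y)) (sym (act-ε _))

  module _ {X : E → Set} (X-closed : Closed X) where
    open Closed X-closed

    self : ∀ {x} → NormalClosure X x x
    self {x} = resp (ε-conj x) (gen has-ε)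

    closure-conj : ∀ {x g y} → X g → NormalClosure X x y → NormalClosure X x (conj g y)
    closure-conj {x} {g} Xg (gen {h} Xh)       = resp (λ z → sym (conj-conj g h x z)) (gen (has-∙ Xg Xh))
    closure-conj {x} {g} Xg one                = resp (λ z → sym (conj-ε g z)) one
    closure-conj {x} {g} Xg (mul {a} {b} p q)  =
      resp (λ z → sym (conj-∙ g a b z)) (mul (closure-conj Xg p) (closure-conj Xg q))
    closure-conj {x} {g} Xg (resp e p)         = resp (conj-≈ g e) (closure-conj Xg p)

    -- For `x` in a finite permutation group `X` this is membership in `O_p`: a normal subgroup all
    -- of whose elements have p-power order is a p-group.
    Radical : ℕ → E → Set
    Radical p x = ∀ {y} → NormalClosure X x y → PElement p y

    module _ (X-resp : ∀ {g h} → g ≈ h → X g → X h) where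

      closure⊆ : ∀ {x y} → X x → NormalClosure X x y → X y
      closure⊆ Xx (gen Xg)   = has-conj Xg Xx
      closure⊆ Xx one        = has-ε
      closure⊆ Xx (mul p q)  = has-∙ (closure⊆ Xx p) (closure⊆ Xx q)
      closure⊆ Xx (resp e p) = X-resp e (closure⊆ Xx p)

      move-past : ∀ a b → a ∙ b ≈ b ∙ conj (b ⁻¹) a
      move-past a b z = begin
        act (a ∙ b) z                 ≡⟨ act-∙ a b z ⟩
        act a (act b z)               ≡⟨ act-⁻¹ʳ b _ ⟨
        act b (act (b ⁻¹) (act a (act b z))) ≡⟨ cong (act b) (conj-act (b ⁻¹) a (act b z)) ⟨
        act b (act (conj (b ⁻¹) a) (act (b ⁻¹) (act b z)))
          ≡⟨ cong (λ w → act b (act (conj (b ⁻¹) a) w)) (act-⁻¹ˡ b z) ⟩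
        act b (act (conj (b ⁻¹) a) z) ≡⟨ act-∙ b _ z ⟨
        act (b ∙ conj (b ⁻¹) a) z     ∎

      -- A conjugate of `x ∙ y` splits into conjugates of `x` and `y`. When factorisations `a ∙ b`
      -- and `a′ ∙ b′` are multiplied, `move-past` carries `b` across `a′` at the cost of a
      -- conjugation.
      closure-∙ : ∀ {x y z} → X x → NormalClosure X (x ∙ y) z →
                  ∃[ a ] ∃[ b ] (NormalClosure X x a × NormalClosure X y b × a ∙ b ≈ z)
      closure-∙ {x} {y} Xx (gen {g} Xg) = conj g x , conj g y , gen Xg , gen Xg , λ w → sym (conj-∙ g x y w)
      closure-∙ Xx one = ε , ε , one , one , λ w → act-ε∙ε w
        where
        act-ε∙ε : ∀ w → act (ε ∙ ε) w ≡ act ε w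
        act-ε∙ε w = trans (act-∙ ε ε w) (act-ε _)
      closure-∙ Xx (mul {z} {z′} p q)
        with a , b , ca , cb , e ← closure-∙ Xx p
           | a′ , b′ , ca′ , cb′ , e′ ← closure-∙ Xx q
        = a ∙ a′ , conj (a′ ⁻¹) b ∙ b′ , mul ca ca′
        , mul (closure-conj (has-⁻¹ (closure⊆ Xx ca′)) cb) cb′
        , λ w → begin
          act (a ∙ a′ ∙ (conj (a′ ⁻¹) b ∙ b′)) w      ≡⟨ act-∙ (a ∙ a′) _ w ⟩
          act (a ∙ a′) (act (conj (a′ ⁻¹) b ∙ b′) w)  ≡⟨ act-∙ a a′ _ ⟩
          act a (act a′ (act (conj (a′ ⁻¹) b ∙ b′) w)) ≡⟨ cong (λ u → act a (act a′ u)) (act-∙ _ b′ w) ⟩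
          act a (act a′ (act (conj (a′ ⁻¹) b) (act b′ w))) ≡⟨ cong (act a) (act-∙ a′ _ _) ⟨
          act a (act (a′ ∙ conj (a′ ⁻¹) b) (act b′ w)) ≡⟨ cong (act a) (move-past b a′ _) ⟨
          act a (act (b ∙ a′) (act b′ w))             ≡⟨ cong (act a) (act-∙ b a′ _) ⟩
          act a (act b (act a′ (act b′ w)))           ≡⟨ act-∙ a b _ ⟨
          act (a ∙ b) (act a′ (act b′ w))             ≡⟨ e _ ⟩
          act z (act a′ (act b′ w))                   ≡⟨ cong (act z) (trans (sym (act-∙ a′ b′ w)) (e′ w)) ⟩
          act z (act z′ w)                            ≡⟨ act-∙ z z′ w ⟨
          act (z ∙ z′) w                              ∎
      closure-∙ Xx (resp e p) with a , b , ca , cb , e′ ← closure-∙ Xx p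
        = a , b , ca , cb , λ w → trans (e′ w) (e w)

      -- Modulo the normal closure of `y` the factor `b` disappears; `b′` is the correction.
      pow-∙ : ∀ {y a b} n → X a → NormalClosure X y b →
              ∃[ b′ ] (NormalClosure X y b′ × pow (a ∙ b) n ≈ pow a n ∙ b′)
      pow-∙ zero Xa cb = ε , one , λ w → sym (trans (act-∙ ε ε w) (act-ε _))
      pow-∙ {y} {a} {b} (suc n) Xa cb with b′ , cb′ , e ← pow-∙ {y} {a} {b} n Xa cb
        = conj (pow a n ⁻¹) b ∙ b′ , mul (closure-conj (has-⁻¹ (has-pow n Xa)) cb) cb′ , λ w → begin
          act (a ∙ b ∙ pow (a ∙ b) n) w               ≡⟨ act-∙ (a ∙ b) _ w ⟩
          act (a ∙ b) (act (pow (a ∙ b) n) w)         ≡⟨ act-∙ a b _ ⟩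
          act a (act b (act (pow (a ∙ b) n) w))       ≡⟨ cong (λ u → act a (act b u)) (trans (e w) (act-∙ _ b′ w)) ⟩
          act a (act b (act (pow a n) (act b′ w)))    ≡⟨ cong (act a) (trans (sym (act-∙ b _ _)) (trans (move-past b (pow a n) _) (act-∙ (pow a n) _ _))) ⟩
          act a (act (pow a n) (act (conj (pow a n ⁻¹) b) (act b′ w))) ≡⟨ cong (λ u → act a (act (pow a n) u)) (act-∙ _ b′ w) ⟨
          act a (act (pow a n) (act (conj (pow a n ⁻¹) b ∙ b′) w)) ≡⟨ act-∙ a _ _ ⟨
          act (a ∙ pow a n) (act (conj (pow a n ⁻¹) b ∙ b′) w) ≡⟨ act-∙ (a ∙ pow a n) _ w ⟨
          act (a ∙ pow a n ∙ (conj (pow a n ⁻¹) b ∙ b′)) w ∎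

      -- Split an element of the closure as `a ∙ b`. The power that kills `a` sends `a ∙ b` into the
      -- closure of `y`, where a further power of `p` kills it.
      radical-∙ : ∀ {p x y} → X x → Radical p x → Radical p y → Radical p (x ∙ y)
      radical-∙ {p} {x} {y} Xx rx ry c
        with a , b , ca , cb , e ← closure-∙ Xx c
        with i , ti ← rx ca
        with b′ , cb′ , e′ ← pow-∙ {y} {a} {b} (p ^ i) (closure⊆ Xx ca) cb
        with j , tj ← ry cb′
        = PElement-≈ e (j + i , λ w → begin
          act (pow (a ∙ b) (p ^ (j + i))) w       ≡⟨ cong (λ N → act (pow (a ∙ b) N) w) (^-distribˡ-+-* p j i) ⟩
          act (pow (a ∙ b) (p ^ j * p ^ i)) w     ≡⟨ pow-* (a ∙ b) (p ^ i) (p ^ j) w ⟨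
          act (pow (pow (a ∙ b) (p ^ i)) (p ^ j)) w ≡⟨ pow-cong (λ u → trans (e′ u) (trans (act-∙ _ b′ u) (ti _))) (p ^ j) w ⟩
          act (pow b′ (p ^ j)) w                  ≡⟨ tj w ⟩
          w                                       ∎)

-- Counting: uniform bounds, fresh points, codes of permutations.

bound-all : ∀ {n} {P : Fin n → ℕ → Set} → (∀ i {a b} → a ≤ b → P i a → P i b) →
            (∀ i → ∃[ a ] P i a) → ∃[ a ] (∀ i → P i a)
bound-all {zero}  mono h = 0 , λ ()
bound-all {suc n} {P} mono h with h zero | bound-all {n} {λ i → P (suc i)} (λ i → mono (suc i)) (λ i → h (suc i))
... | a , pa | b , pb = a ⊔ b , λ where
  zero    → mono zero (m≤m⊔n a b) pa
  (suc i) → mono (suc i) (m≤n⊔m a b) (pb i)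

fresh : ∀ {m} (xs : List (Fin m)) → length xs < m → ∃[ z ] All (z ≢_) xs
fresh {m} xs l<m with any? (λ z → ¬? (DM._∈?_ _≟_ z xs))
... | yes (z , z∉xs) = z , ¬Any⇒All¬ xs z∉xs
... | no all∈ = ⊥-elim (1+n≰n (≤-trans l<m (injective⇒≤ {f = λ z → index (mem z)} λ {x} {y} e → index-injective (setoid _) (mem x) (mem y) e)))
  where
  mem : ∀ z → z ∈ xs
  mem z = decidable-stable (DM._∈?_ _≟_ z xs) (λ n → all∈ (z , n))

-- A Lehmer code: the first value, then the code of the remaining values with the first one punched
-- out. It makes the count `l !` available to the pigeonhole principle.
code : ∀ {l} (φ : Fin l → Fin l) → (∀ i j → φ i ≡ φ j → i ≡ j) → Fin (l !)
code {zero}  φ inj = zero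
code {suc l} φ inj = combine (φ zero) (code (λ i → punchOut (ne i)) λ i j e → suc-injective (inj _ _ (punchOut-injective (ne i) (ne j) e)))
  where
  ne : ∀ i → φ zero ≢ φ (suc i)
  ne i e with () ← inj _ _ e

punchOut-inj₂ : ∀ {n} {i i′ j k : Fin (suc n)} (p : i ≢ j) (q : i′ ≢ k) → i ≡ i′ → punchOut p ≡ punchOut q → j ≡ k
punchOut-inj₂ p q refl = punchOut-injective p q

code-injective : ∀ {l} (φ ψ : Fin l → Fin l) iφ iψ → code φ iφ ≡ code ψ iψ → ∀ i → φ i ≡ ψ i
code-injective {suc l} φ ψ iφ iψ e zero = combine-injectiveˡ (φ zero) _ (ψ zero) _ e
code-injective {suc l} φ ψ iφ iψ e (suc i) =
  punchOut-inj₂ _ _ (combine-injectiveˡ (φ zero) _ (ψ zero) _ e)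
    (code-injective _ _ _ _ (combine-injectiveʳ (φ zero) _ (ψ zero) _ e) i)

-- half i = (i + 2)! / 2, the order of the alternating group of degree i + 2.
half : ℕ → ℕ
half zero    = 1
half (suc i) = (3 + i) * half i

half>0 : ∀ i → 0 < half i
half>0 zero    = z<s
half>0 (suc i) = *-mono-≤ {1} {3 + i} (s≤s z≤n) (half>0 i)

fact-half : ∀ i → (2 + i) ! ≡ 2 * half i
fact-half zero    = refl
fact-half (suc i) = begin
  (3 + i) * (2 + i) !    ≡⟨ cong ((3 + i) *_) (fact-half i) ⟩
  (3 + i) * (2 * half i) ≡⟨ *-assoc (3 + i) 2 (half i) ⟨
  (3 + i) * 2 * half i   ≡⟨ cong (_* half i) (*-comm (3 + i) 2) ⟩
  2 * (3 + i) * half i   ≡⟨ *-assoc 2 (3 + i) (half i) ⟩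
  2 * ((3 + i) * half i) ∎
  where open ≡-Reasoning

!>0 : ∀ n → 1 ≤ n !
!>0 zero    = ≤-refl
!>0 (suc n) = *-mono-≤ {1} {suc n} (s≤s z≤n) (!>0 n)

!-mono : ∀ {a b} → a ≤ b → a ! ≤ b !
!-mono {b = b} z≤n = !>0 b
!-mono (s≤s p)     = *-mono-≤ (s≤s p) (!-mono p)

-- `(2 + i) !` is twice `half i`, while `half (suc i)` is `3 + i` times it.
fact<half : ∀ {l} i → l ≤ 2 + i → l ! < half (suc i)
fact<half {l} i l≤ = ≤-<-trans (!-mono l≤) (subst (_< half (suc i)) (sym (fact-half i))
  (*-monoˡ-< (half i) {{>-nonZero (half>0 i)}} {2} {3 + i} (s≤s (s≤s (s≤s z≤n)))))

collision : ∀ {N l} → l ! < N → (φ : Fin N → Fin l → Fin l) → (∀ x a b → φ x a ≡ φ x b → a ≡ b) →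
            ∃[ x ] ∃[ x′ ] (x ≢ x′ × (∀ a → φ x a ≡ φ x′ a))
collision l!<N φ inj with x , x′ , x<x′ , e ← pigeonhole l!<N (λ x → code (φ x) (inj x))
  = x , x′ , (λ eq → <⇒≢ x<x′ eq) , code-injective _ _ _ _ e

-- Three-cycles and normal subgroups of alternating groups.

module Cycles {𝒢 : RawGrp} {m : ℕ} (α : Action 𝒢 (Fin m)) where
  open ActionProps α

  record Cyc (g : E) (a b c : Fin m) : Set where
    constructor mkCyc
    field
      a≢b : a ≢ b
      b≢c : b ≢ c
      c≢a : c ≢ a
      a→b : act g a ≡ b
      b→c : act g b ≡ c
      c→a : act g c ≡ a
      rest : ∀ {x} → x ≢ a → x ≢ b → x ≢ c → act g x ≡ x
  open Cyc public

  Cyc-conj : ∀ g {h a b c} → Cyc h a b c → Cyc (conj g h) (act g a) (act g b) (act g c)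
  Cyc-conj g {h} {a} {b} {c} C = mkCyc (λ e → a≢b C (act-inj g e)) (λ e → b≢c C (act-inj g e)) (λ e → c≢a C (act-inj g e))
    (trans (conj-act g h a) (cong (act g) (a→b C)))
    (trans (conj-act g h b) (cong (act g) (b→c C)))
    (trans (conj-act g h c) (cong (act g) (c→a C)))
    λ {x} p q r → begin
      act (conj g h) x                      ≡⟨ cong (act (conj g h)) (act-⁻¹ʳ g x) ⟨
      act (conj g h) (act g (act (g ⁻¹) x)) ≡⟨ conj-act g h _ ⟩
      act g (act h (act (g ⁻¹) x))          ≡⟨ cong (act g) (rest C (pull p) (pull q) (pull r)) ⟩
      act g (act (g ⁻¹) x)                  ≡⟨ act-⁻¹ʳ g x ⟩
      x                                     ∎
    where
    open ≡-Reasoning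
    pull : ∀ {x y} → x ≢ act g y → act (g ⁻¹) x ≢ y
    pull {x} n e = n (trans (sym (act-⁻¹ʳ g x)) (cong (act g) e))

  Cyc-⁻¹ : ∀ {h a b c} → Cyc h a b c → Cyc (h ⁻¹) a c b
  Cyc-⁻¹ {h} C = mkCyc (λ e → c≢a C (sym e)) (λ e → b≢c C (sym e)) (λ e → a≢b C (sym e))
    (act-⁻¹ h (c→a C)) (act-⁻¹ h (b→c C)) (act-⁻¹ h (a→b C)) λ p q r → act-⁻¹ h (rest C p r q)

  Cyc-≡ : ∀ {h a b c a′ b′ c′} → a ≡ a′ → b ≡ b′ → c ≡ c′ → Cyc h a b c → Cyc h a′ b′ c′
  Cyc-≡ refl refl refl C = C

  -- The base point o, which all cycles avoid, will be the edge of the matching that is stabilised.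
  HasCycles : Fin m → (E → Set) → Set
  HasCycles o X = ∀ {a b c} → a ≢ o → b ≢ o → c ≢ o → a ≢ b → b ≢ c → c ≢ a → ∃[ g ] (X g × Cyc g a b c)

  -- The classical argument for the simplicity of alternating groups of degree at least 5, carried
  -- out on the points other than `o`: a nontrivial `N` normalised by `K` has all 3-cycles.
  module Normal (o : Fin m) (m≥6 : 6 ≤ m) (K N : E → Set)
    (K-ε : K ε) (K-fix : ∀ {g} → K g → act g o ≡ o) (K-cycles : HasCycles o K)
    (N⊆K : ∀ {g} → N g → K g)
    (N-∙ : ∀ {g h} → N g → N h → N (g ∙ h)) (N-⁻¹ : ∀ {g} → N g → N (g ⁻¹))
    (N-conj : ∀ {g h} → K g → N h → N (conj g h))
    where

    ACycle : Set
    ACycle = ∃[ g ] ∃[ a ] ∃[ b ] ∃[ c ] (N g × Cyc g a b c × a ≢ o × b ≢ o × c ≢ o)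

    moved≢o : ∀ {g x} → K g → act g x ≢ x → x ≢ o
    moved≢o Kg n refl = n (K-fix Kg)

    image≢o : ∀ {g x} → K g → x ≢ o → act g x ≢ o
    image≢o {g} Kg n e = n (act-inj g (trans e (sym (K-fix Kg))))

    -- The commutator σ τ σ⁻¹ τ⁻¹ as a product of the 3-cycles σ τ σ⁻¹ and τ⁻¹.
    record Commutator (σ : E) (a b c : Fin m) : Set where
      field
        ρ u v : E
        ρ∈N : N ρ
        ρ-act : ∀ {x y z} → act v x ≡ y → act u y ≡ z → act ρ x ≡ z
        uC : Cyc u (act σ a) (act σ b) (act σ c)
        vC : Cyc v a c b

    commutator : ∀ {σ a b c} → N σ → a ≢ o → b ≢ o → c ≢ o → a ≢ b → b ≢ c → c ≢ a → Commutator σ a b c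
    commutator {σ} σN ao bo co ab bc ca with τ , τK , τC ← K-cycles ao bo co ab bc ca = record
      { ρ = σ ∙ conj τ (σ ⁻¹) ; u = conj σ τ ; v = τ ⁻¹
      ; ρ∈N = N-∙ σN (N-conj τK (N-⁻¹ σN))
      ; ρ-act = λ { refl refl → pointwise _ }
      ; uC = Cyc-conj σ τC
      ; vC = Cyc-⁻¹ τC }
      where
      open ≡-Reasoning
      pointwise : ∀ x → act (σ ∙ conj τ (σ ⁻¹)) x ≡ act (conj σ τ) (act (τ ⁻¹) x)
      pointwise x = begin
        act (σ ∙ conj τ (σ ⁻¹)) x                  ≡⟨ act-∙ σ _ x ⟩
        act σ (act (conj τ (σ ⁻¹)) x)              ≡⟨ cong (act σ) (act-∙ (τ ∙ σ ⁻¹) _ x) ⟩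
        act σ (act (τ ∙ σ ⁻¹) (act (τ ⁻¹) x))      ≡⟨ cong (act σ) (act-∙ τ _ _) ⟩
        act σ (act τ (act (σ ⁻¹) (act (τ ⁻¹) x)))  ≡⟨ act-∙ σ τ _ ⟨
        act (σ ∙ τ) (act (σ ⁻¹) (act (τ ⁻¹) x))    ≡⟨ act-∙ (σ ∙ τ) _ _ ⟨
        act (conj σ τ) (act (τ ⁻¹) x)              ∎

    -- With `τ = (a b c)` the conjugate `σ τ σ⁻¹` is `(b c d)`, and `(b c d)(a c b) = (a d b)`, the
    -- right factor acting first.
    from-path : ∀ {σ a b c d} → N σ → act σ a ≡ b → act σ b ≡ c → act σ c ≡ d →
                a ≢ b → a ≢ c → a ≢ d → b ≢ c → b ≢ d → c ≢ d → ACycle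
    from-path {σ} {a} {b} {c} {d} σN ab bc cd a≢b a≢c a≢d b≢c b≢d c≢d = ρ , a , d , b , ρ∈N ,
      mkCyc a≢d (λ e → b≢d (sym e)) (λ e → a≢b (sym e))
        (ρ-act (a→b vC) (b→c uC′)) (ρ-act (rest vC (λ e → a≢d (sym e)) (λ e → c≢d (sym e)) (λ e → b≢d (sym e))) (c→a uC′))
        (ρ-act (c→a vC) (rest uC′ a≢b a≢c a≢d))
        others
      , a≢o , d≢o , b≢o
      where
      a≢o = moved≢o (N⊆K σN) (λ e → a≢b (trans (sym e) ab))
      b≢o = subst (_≢ o) ab (image≢o (N⊆K σN) a≢o)
      c≢o = subst (_≢ o) bc (image≢o (N⊆K σN) b≢o)
      d≢o = subst (_≢ o) cd (image≢o (N⊆K σN) c≢o)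
      open Commutator (commutator {σ} σN a≢o b≢o c≢o a≢b b≢c (λ e → a≢c (sym e)))
      uC′ : Cyc u b c d
      uC′ = Cyc-≡ ab bc cd uC
      others : ∀ {x} → x ≢ a → x ≢ d → x ≢ b → act ρ x ≡ x
      others {x} xa xd xb with x ≟ c
      ... | yes refl = ρ-act (b→c vC) (a→b uC′)
      ... | no xc    = ρ-act (rest vC xa xc xb) (rest uC′ xb xc xd)

    -- With `τ = (a b z)` the commutator is `(b a z)(a z b) = (a b z)`.
    from-swap : ∀ {σ a b z} → N σ → act σ a ≡ b → act σ b ≡ a → act σ z ≡ z →
                a ≢ b → z ≢ a → z ≢ b → z ≢ o → ACycle
    from-swap {σ} {a} {b} {z} σN ab ba zz a≢b z≢a z≢b z≢o = ρ , a , b , z , ρ∈N ,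
      mkCyc a≢b (λ e → z≢b (sym e)) z≢a
        (ρ-act (a→b vC) (c→a uC′)) (ρ-act (c→a vC) (b→c uC′)) (ρ-act (b→c vC) (a→b uC′))
        (λ xa xb xz → ρ-act (rest vC xa xz xb) (rest uC′ xb xa xz))
      , a≢o , b≢o , z≢o
      where
      a≢o = moved≢o (N⊆K σN) (λ e → a≢b (trans (sym e) ab))
      b≢o = subst (_≢ o) ab (image≢o (N⊆K σN) a≢o)
      open Commutator (commutator {σ} σN a≢o b≢o z≢o a≢b (λ e → z≢b (sym e)) z≢a)
      uC′ : Cyc u b a z
      uC′ = Cyc-≡ ab ba zz uC

    -- If a fresh `z` is moved, the commutator with `τ = (a b z)` swaps `a` and `z` and fixes every
    -- point other than `a`, `b`, `z` and `act σ z`, so `from-swap` applies to it. Finding such a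
    -- point different from `o` needs `6 ≤ m`.
    from-swap′ : ∀ {σ a b} → N σ → act σ a ≡ b → act σ b ≡ a → a ≢ b → ACycle
    from-swap′ {σ} {a} {b} σN ab ba a≢b
      with z , z≢o ∷ z≢a ∷ z≢b ∷ [] ← fresh (o ∷ a ∷ b ∷ []) (≤-trans (s≤s (s≤s (s≤s (s≤s z≤n)))) m≥6)
      with act σ z ≟ z
    ... | yes zz = from-swap σN ab ba zz a≢b z≢a z≢b z≢o
    ... | no z′≢z
      with f , f≢o ∷ f≢a ∷ f≢b ∷ f≢z ∷ f≢z′ ∷ [] ← fresh (o ∷ a ∷ b ∷ z ∷ act σ z ∷ []) m≥6
      = from-swap ρ∈N
          (ρ-act (a→b vC) (rest uC′ z≢b z≢a (λ e → z′≢z (sym e))))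
          (ρ-act (b→c vC) (a→b uC′))
          (ρ-act (rest vC f≢a f≢z f≢b) (rest uC′ f≢b f≢a f≢z′))
          (λ e → z≢a (sym e)) f≢a f≢z f≢o
      where
      a≢o = moved≢o (N⊆K σN) (λ e → a≢b (trans (sym e) ab))
      b≢o = subst (_≢ o) ab (image≢o (N⊆K σN) a≢o)
      open Commutator (commutator {σ} σN a≢o b≢o z≢o a≢b (λ e → z≢b (sym e)) z≢a)
      uC′ : Cyc u b a (act σ z)
      uC′ = Cyc-≡ ab ba refl uC

    -- Take `τ = (a b z)` with `z` off the cycle. If `σ` fixes `z`, the commutator `(b c z)(a z b)`
    -- swaps `a` and `b`; otherwise it carries `a` to `z`, `z` to `c` and `c` to `act σ z`, a path
    -- for `from-path`.
    from-3cycle : ∀ {σ a b c} → N σ → act σ a ≡ b → act σ b ≡ c → act σ c ≡ a → a ≢ b → b ≢ c → c ≢ a → ACycle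
    from-3cycle {σ} {a} {b} {c} σN ab bc ca a≢b b≢c c≢a
      with z , z≢o ∷ z≢a ∷ z≢b ∷ z≢c ∷ [] ← fresh (o ∷ a ∷ b ∷ c ∷ []) (≤-trans (s≤s (s≤s (s≤s (s≤s (s≤s z≤n))))) m≥6)
      with act σ z ≟ z
    ... | yes zz
      with f , f≢o ∷ f≢a ∷ f≢b ∷ f≢c ∷ f≢z ∷ [] ← fresh (o ∷ a ∷ b ∷ c ∷ z ∷ []) m≥6
      = from-swap ρ∈N
          (ρ-act (a→b vC) (c→a uC′))
          (ρ-act (c→a vC) (rest uC′ a≢b (λ e → c≢a (sym e)) (λ e → z≢a (sym e))))
          (ρ-act (rest vC f≢a f≢z f≢b) (rest uC′ f≢b f≢c f≢z))
          a≢b f≢a f≢b f≢o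
      where
      a≢o = moved≢o (N⊆K σN) (λ e → a≢b (trans (sym e) ab))
      b≢o = subst (_≢ o) ab (image≢o (N⊆K σN) a≢o)
      open Commutator (commutator {σ} σN a≢o b≢o z≢o a≢b (λ e → z≢b (sym e)) z≢a)
      uC′ : Cyc u b c z
      uC′ = Cyc-≡ ab bc zz uC
    ... | no z′≢z
      = from-path ρ∈N
          (ρ-act (a→b vC) (rest uC′ z≢b z≢c (λ e → z′≢z (sym e))))
          (ρ-act (b→c vC) (a→b uC′))
          (ρ-act (rest vC c≢a (λ e → z≢c (sym e)) (λ e → b≢c (sym e))) (b→c uC′))
          (λ e → z≢a (sym e)) (λ e → c≢a (sym e)) (λ e → z≢c (act-inj σ (trans (sym e) (sym ca))))
          z≢c (λ e → z′≢z (sym e)) (λ e → z≢b (act-inj σ (trans (sym e) (sym bc))))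
      where
      a≢o = moved≢o (N⊆K σN) (λ e → a≢b (trans (sym e) ab))
      b≢o = subst (_≢ o) ab (image≢o (N⊆K σN) a≢o)
      open Commutator (commutator {σ} σN a≢o b≢o z≢o a≢b (λ e → z≢b (sym e)) z≢a)
      uC′ : Cyc u b c (act σ z)
      uC′ = Cyc-≡ ab bc refl uC

    -- The cases are orbits of `a` of length two, three, and at least four.
    nontrivial⇒cycle : ∀ {σ a} → N σ → act σ a ≢ a → ACycle
    nontrivial⇒cycle {σ} {a} σN b≢a with act σ (act σ a) ≟ a
    ... | yes ba = from-swap′ σN refl ba (λ e → b≢a (sym e))
    ... | no c≢a with act σ (act σ (act σ a)) ≟ a
    ...   | yes ca = from-3cycle σN refl refl ca (λ e → b≢a (sym e)) (λ e → b≢a (sym (act-inj σ e))) c≢a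
    ...   | no d≢a = from-path σN refl refl refl (λ e → b≢a (sym e)) (λ e → c≢a (sym e)) (λ e → d≢a (sym e))
                       (λ e → b≢a (sym (act-inj σ e))) (λ e → c≢a (sym (act-inj σ e)))
                       (λ e → b≢a (sym (act-inj σ (act-inj σ e))))

    -- A 3-cycle `(p q z)` does this, with `z` chosen away from `xs` and from `o`, `p`, `q`; the
    -- bound leaves room for `z`.
    shift : ∀ {p q} xs → 3 + length xs < m → p ≢ o → q ≢ o → All (p ≢_) xs → All (q ≢_) xs →
            ∃[ g ] (K g × act g p ≡ q × All (λ x → act g x ≡ x) xs)
    shift {p} {q} xs l p≢o q≢o p≢xs q≢xs with p ≟ q
    ... | yes refl = ε , K-ε , act-ε p , All.universal act-ε xs
    ... | no p≢q with fresh (o ∷ p ∷ q ∷ xs) l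
    ...   | z , z≢o ∷ z≢p ∷ z≢q ∷ z≢xs
      with g , Kg , C ← K-cycles p≢o q≢o z≢o p≢q (λ e → z≢q (sym e)) z≢p
      = g , Kg , a→b C , All.zipWith (λ { (pp , qq , zz) → rest C (λ e → pp (sym e)) (λ e → qq (sym e)) (λ e → zz (sym e)) })
          (p≢xs , All.zip (q≢xs , z≢xs))

    -- Conjugations put `a`, `b`, `c` into place one after another, each fixing the points placed
    -- before. The last one spares two placed points and uses `6 ≤ m` exactly.
    cycle⇒all : ACycle → HasCycles o N
    cycle⇒all (g , a , b , c , Ng , C , a≢o , b≢o , c≢o) {a′} {b′} {c′} a′≢o b′≢o c′≢o a′≢b′ b′≢c′ c′≢a′
      with h₁ , K₁ , e₁ , [] ← shift {a} {a′} [] (≤-trans (s≤s (s≤s (s≤s (s≤s z≤n)))) m≥6) a≢o a′≢o [] []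
      with C₁ ← Cyc-conj h₁ C
      with h₂ , K₂ , e₂ , f₂ ∷ [] ← shift {act h₁ b} {b′} (a′ ∷ []) (≤-trans (s≤s (s≤s (s≤s (s≤s (s≤s z≤n))))) m≥6)
                                      (image≢o K₁ b≢o) b′≢o ((λ e → a≢b C₁ (trans e₁ (sym e))) ∷ []) ((λ e → a′≢b′ (sym e)) ∷ [])
      with C₂ ← Cyc-conj h₂ C₁
      with h₃ , K₃ , e₃ , f₃ ∷ f₃′ ∷ [] ← shift {act h₂ (act h₁ c)} {c′} (a′ ∷ b′ ∷ []) m≥6
                                      (image≢o K₂ (image≢o K₁ c≢o)) c′≢o
                                      ((λ e → c≢a C₂ (trans e (sym (trans (cong (act h₂) e₁) f₂)))) ∷ (λ e → b≢c C₂ (trans e₂ (sym e))) ∷ [])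
                                      (c′≢a′ ∷ (λ e → b′≢c′ (sym e)) ∷ [])
      = conj h₃ (conj h₂ (conj h₁ g)) , N-conj K₃ (N-conj K₂ (N-conj K₁ Ng)) ,
        Cyc-≡ (trans (cong (act h₃) (trans (cong (act h₂) e₁) f₂)) f₃)
              (trans (cong (act h₃) e₂) f₃′) e₃ (Cyc-conj h₃ C₂)

    all-cycles : ∀ {σ a} → N σ → act σ a ≢ a → HasCycles o N
    all-cycles σN n = cycle⇒all (nontrivial⇒cycle σN n)

-- Alternating groups acting on few points.

module AlternatingStep {𝒢 : RawGrp} {i n : ℕ} (α : Action 𝒢 (Fin (4 + i))) (β : Action 𝒢 (Fin n)) (i≥2 : 2 ≤ i) where
  open RawGrp 𝒢
  open Action β renaming (act to actᵛ; act-∙ to actᵛ-∙; act-ε to actᵛ-ε; act-⁻¹ˡ to actᵛ-⁻¹ˡ; act-⁻¹ʳ to actᵛ-⁻¹ʳ)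
  open ActionProps α using (act; act-∙; act-ε; act-⁻¹ˡ; act-⁻¹ʳ; act-inj)
  module β = ActionProps β
  open Cycles α

  module _ (K : E → Set) (K-closed : Closed K) (K-fix : ∀ {g} → K g → act g zero ≡ zero)
           (K-cycles : HasCycles zero K) where
    open Closed K-closed

    -- As many distinct permutations of the points `1` to `2 + j` as there are in the alternating
    -- group on them.
    record Family (j : ℕ) : Set where
      field
        elt   : Fin (half j) → E
        inK   : ∀ x → K (elt x)
        fixes : ∀ x y → 2 + j < toℕ y → act (elt x) y ≡ y
        inj   : ∀ x x′ → (∀ y → act (elt x) y ≡ act (elt x′) y) → x ≡ x′

    -- A 3-cycle through `y`, `c` and an auxiliary point, namely `1`, or `2` when `c` is `1`. Both
    -- lie below `y`, so nothing above `y` moves.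
    mover : ∀ (y c : Fin (4 + i)) → 2 < toℕ y → 0 < toℕ c → toℕ c ≤ toℕ y →
            ∃[ g ] (K g × act g y ≡ c × (∀ x → toℕ y < toℕ x → act g x ≡ x))
    mover y c 2<y 0<c c≤y with y ≟ c
    ... | yes refl = ε , has-ε , act-ε y , λ x _ → act-ε x
    ... | no y≢c = pick (suc zero ≟ c)
      where
      above : ∀ {x z : Fin (4 + i)} → toℕ z ≤ toℕ y → toℕ y < toℕ x → x ≢ z
      above z≤y y<x refl = <-irrefl refl (≤-trans y<x z≤y)
      with-aux : ∀ z → z ≢ zero → z ≢ c → toℕ z < toℕ y →
                 ∃[ g ] (K g × act g y ≡ c × (∀ x → toℕ y < toℕ x → act g x ≡ x))
      with-aux z z≢o z≢c z<y with g , Kg , C ← K-cycles {y} {c} {z} (λ { refl → n≮0 2<y }) (λ { refl → n≮0 0<c }) z≢o y≢c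
                                    (λ e → z≢c (sym e)) (λ { refl → <-irrefl refl z<y })
        = g , Kg , a→b C , λ x y<x → rest C (above ≤-refl y<x) (above c≤y y<x) (above (≤-trans (n≤1+n _) z<y) y<x)
      pick : Dec (suc zero ≡ c) → ∃[ g ] (K g × act g y ≡ c × (∀ x → toℕ y < toℕ x → act g x ≡ x))
      pick (yes refl) = with-aux (suc (suc zero)) (λ ()) (λ ()) 2<y
      pick (no 1≢c)   = with-aux (suc zero) (λ ()) 1≢c (≤-trans (s≤s (s≤s z≤n)) 2<y)

    -- A coset count: each new element is an element of the smaller family followed by a mover of
    -- the point `3 + j`. The image of that point recovers the mover, so the size is multiplied by
    -- `3 + j`.
    family : ∀ j → j ≤ suc i → Family j
    family zero _ = record { elt = λ _ → ε ; inK = λ _ → has-ε ; fixes = λ _ y _ → act-ε y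
                           ; inj = λ { zero zero _ → refl } }
    family (suc j) j<i = record
      { elt = λ x → let c , r = remQuot {3 + j} (half j) x in mv c ∙ elt r
      ; inK = λ x → let c , r = remQuot {3 + j} (half j) x in has-∙ (mv-K c) (inK r)
      ; fixes = λ x z lt → let c , r = remQuot {3 + j} (half j) x in
          trans (act-∙ _ _ z) (trans (cong (act (mv c)) (fixes r z (≤-trans (n≤1+n _) lt)))
            (mv-fix c z (subst (_< toℕ z) (sym toℕy) lt)))
      ; inj = λ x x′ e → trans (sym (combine-remQuot {3 + j} (half j) x))
          (trans (cong (λ { (c , r) → combine c r }) (pair-inj (remQuot {3 + j} (half j) x) (remQuot {3 + j} (half j) x′) e))
            (combine-remQuot {3 + j} (half j) x′))
      }
      where
      open Family (family j (≤-trans (n≤1+n j) j<i))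
      y<m : 3 + j < 4 + i
      y<m = s≤s (s≤s (s≤s j<i))
      y : Fin (4 + i)
      y = fromℕ< y<m
      toℕy : toℕ y ≡ 3 + j
      toℕy = toℕ-fromℕ< y<m
      pt : Fin (3 + j) → Fin (4 + i)
      pt c = fromℕ< (≤-<-trans (toℕ<n c) y<m)
      toℕpt : ∀ c → toℕ (pt c) ≡ suc (toℕ c)
      toℕpt c = toℕ-fromℕ< (≤-<-trans (toℕ<n c) y<m)
      mvr : ∀ c → _
      mvr c = mover y (pt c) (subst (2 <_) (sym toℕy) (s≤s (s≤s (s≤s z≤n)))) (subst (0 <_) (sym (toℕpt c)) (s≤s z≤n))
                (subst (_≤ toℕ y) (sym (toℕpt c)) (subst (suc (toℕ c) ≤_) (sym toℕy) (toℕ<n c)))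
      mv : Fin (3 + j) → E
      mv c = proj₁ (mvr c)
      mv-K : ∀ c → K (mv c)
      mv-K c = proj₁ (proj₂ (mvr c))
      mv-y : ∀ c → act (mv c) y ≡ pt c
      mv-y c = proj₁ (proj₂ (proj₂ (mvr c)))
      mv-fix : ∀ c x → toℕ y < toℕ x → act (mv c) x ≡ x
      mv-fix c = proj₂ (proj₂ (proj₂ (mvr c)))
      at-y : ∀ c r → act (mv c ∙ elt r) y ≡ pt c
      at-y c r = trans (act-∙ _ _ y) (trans (cong (act (mv c)) (fixes r y (subst (2 + j <_) (sym toℕy) ≤-refl))) (mv-y c))
      pt-inj : ∀ {c c′} → pt c ≡ pt c′ → c ≡ c′
      pt-inj {c} {c′} e = toℕ-injective (ℕ-suc-injective (trans (sym (toℕpt c)) (trans (cong toℕ e) (toℕpt c′))))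
      pair-inj : ∀ (p p′ : Fin (3 + j) × Fin (half j)) →
                 (∀ z → act (mv (proj₁ p) ∙ elt (proj₂ p)) z ≡ act (mv (proj₁ p′) ∙ elt (proj₂ p′)) z) → p ≡ p′
      pair-inj (c , r) (c′ , r′) e with refl ← pt-inj {c} {c′} (trans (sym (at-y c r)) (trans (e y) (at-y c′ r′)))
        = cong (c ,_) (inj r r′ λ z → act-inj (mv c) (trans (sym (act-∙ _ _ z)) (trans (e z) (act-∙ _ _ z))))

    module _ {l : ℕ} (l≤ : l ≤ 2 + i) (ω : Fin l → Fin n) (ω-inj : ∀ {a b} → ω a ≡ ω b → a ≡ b)
             (ω-stable : ∀ {g} → K g → ∀ a → ∃[ b ] actᵛ g (ω a) ≡ ω b) where

      K₀ : E → Set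
      K₀ g = K g × (∀ a → actᵛ g (ω a) ≡ ω a)

      induced : ∀ {g} → K g → Fin l → Fin l
      induced Kg a = proj₁ (ω-stable Kg a)

      induced-inj : ∀ {g} (Kg : K g) a b → induced Kg a ≡ induced Kg b → a ≡ b
      induced-inj {g} Kg a b e = ω-inj (β.act-inj g (trans (proj₂ (ω-stable Kg a)) (trans (cong ω e) (sym (proj₂ (ω-stable Kg b))))))

      difference : ∀ {g h} (Kg : K g) (Kh : K h) → (∀ a → induced Kg a ≡ induced Kh a) →
                   ¬ (∀ y → act g y ≡ act h y) → ∃[ k ] ∃[ a ] (K₀ k × act k a ≢ a)
      difference {g} {h} Kg Kh e ne = h ⁻¹ ∙ g , proj₁ moved , (has-∙ (has-⁻¹ Kh) Kg , fixω) , proj₂ moved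
        where
        moved : ∃[ a ] (act (h ⁻¹ ∙ g) a ≢ a)
        moved = ¬∀⟶∃¬ _ _ (λ a → act (h ⁻¹ ∙ g) a ≟ a) λ all → ne λ y →
          trans (sym (act-⁻¹ʳ h _)) (cong (act h) (trans (sym (act-∙ _ _ y)) (all y)))
        fixω : ∀ b → actᵛ (h ⁻¹ ∙ g) (ω b) ≡ ω b
        fixω b = trans (actᵛ-∙ _ _ (ω b)) (β.act-⁻¹ h
                   (trans (proj₂ (ω-stable Kh b)) (trans (cong ω (sym (e b))) (sym (proj₂ (ω-stable Kg b))))))

      K₀-nontrivial : ∀ {j} → l ! < half j → Family j → ∃[ g ] ∃[ a ] (K₀ g × act g a ≢ a)
      K₀-nontrivial l!< F =
        let x , x′ , x≢x′ , e = collision l!< (λ x → induced (inK x)) (λ x → induced-inj (inK x))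
        in difference (inK x) (inK x′) e λ eq → x≢x′ (inj x x′ eq)
        where open Family F

      K₀-∙ : ∀ {g h} → K₀ g → K₀ h → K₀ (g ∙ h)
      K₀-∙ {g} {h} (Kg , fg) (Kh , fh) = has-∙ Kg Kh , λ a → β.fix-∙ g h (fg a) (fh a)

      K₀-⁻¹ : ∀ {g} → K₀ g → K₀ (g ⁻¹)
      K₀-⁻¹ {g} (Kg , fg) = has-⁻¹ Kg , λ a → β.act-⁻¹ g (fg a)

      K₀-conj : ∀ {g h} → K g → K₀ h → K₀ (conj g h)
      K₀-conj {g} {h} Kg (Kh , fh) = has-conj Kg Kh , λ a →
        let b , e = ω-stable (has-⁻¹ Kg) a
            e′ = trans (cong (actᵛ g) (sym e)) (actᵛ-⁻¹ʳ g (ω a))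
        in trans (cong (actᵛ (conj g h)) (sym e′)) (trans (β.conj-act g h (ω b)) (trans (cong (actᵛ g) (fh b)) e′))

      -- The members of the family outnumber the permutations of the `l` points, so a quotient of
      -- two of them lies in `K₀` and acts nontrivially under `α`. Since `K` normalises `K₀`, the
      -- argument of `Normal` yields all 3-cycles.
      K₀-cycles : HasCycles zero K₀
      K₀-cycles =
        let g , a , Kg , ne = K₀-nontrivial (fact<half i l≤) (family (suc i) ≤-refl)
        in Normal.all-cycles zero (s≤s (s≤s (s≤s (s≤s i≥2)))) K K₀ has-ε K-fix K-cycles proj₁
             (λ {g} {h} → K₀-∙ {g} {h}) (λ {g} → K₀-⁻¹ {g}) (λ {g} {h} → K₀-conj {g} {h}) {g} {a} Kg ne

-- Neighbourhoods and graph automorphisms.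

lookup-injective : ∀ {A : Set} {xs : List A} → Unique xs → ∀ {i j} → lookup xs i ≡ lookup xs j → i ≡ j
lookup-injective (x∉ ∷ u) {zero}  {zero}  e = refl
lookup-injective (x∉ ∷ u) {zero}  {suc j} e = ⊥-elim (All.lookup x∉ (∈-lookup j) e)
lookup-injective (x∉ ∷ u) {suc i} {zero}  e = ⊥-elim (All.lookup x∉ (∈-lookup i) (sym e))
lookup-injective (x∉ ∷ u) {suc i} {suc j} e = cong suc (lookup-injective u e)

length-mono : ∀ {A B : Set} {xs : List A} {ys : List B} (f : A → B) → Unique xs →
              (∀ {x y} → f x ≡ f y → x ≡ y) → (∀ {z} → z ∈ xs → f z ∈ ys) → length xs ≤ length ys
length-mono {xs = xs} f u f-inj sub = injective⇒≤ {f = λ i → index (sub (∈-lookup i))}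
  λ {i} {j} e → lookup-injective u (f-inj (index-injective (setoid _) (sub (∈-lookup i)) (sub (∈-lookup j)) e))

module Neighbours (Γ : Graph) where
  V : Set
  V = Fin (n Γ)

  Adj-sym : ∀ {u v} → Adj Γ u v → Adj Γ v u
  Adj-sym {u} {v} = subst T (Graph.sym Γ u v)

  Adj-irrefl : ∀ {v} → ¬ Adj Γ v v
  Adj-irrefl {v} = subst T (irrefl Γ v)

  Adj? : ∀ u v → Dec (Adj Γ u v)
  Adj? u v = T? (adj Γ u v)

  nbrs : V → List V
  nbrs y = filter (Adj? y) (allFin (n Γ))

  nbrs-unique : ∀ y → Unique (nbrs y)
  nbrs-unique y = filter⁺ (Adj? y) (allFin⁺ (n Γ))

  ∈-nbrs : ∀ {y z} → Adj Γ y z → z ∈ nbrs y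
  ∈-nbrs {y} {z} a = ∈-filter⁺ (Adj? y) (∈-allFin z) a

  nbrs-∈ : ∀ {y z} → z ∈ nbrs y → Adj Γ y z
  nbrs-∈ {y} p = proj₂ (∈-filter⁻ (Adj? y) {xs = allFin (n Γ)} p)

  others : V → V → List V
  others x y = filter (λ z → ¬? (z ≟ x)) (nbrs y)

  others-unique : ∀ x y → Unique (others x y)
  others-unique x y = filter⁺ (λ z → ¬? (z ≟ x)) (nbrs-unique y)

  ∈-others : ∀ {x y z} → Adj Γ y z → z ≢ x → z ∈ others x y
  ∈-others {x} a z≢x = ∈-filter⁺ (λ z → ¬? (z ≟ x)) (∈-nbrs a) z≢x

  others-∈ : ∀ {x y z} → z ∈ others x y → Adj Γ y z × z ≢ x
  others-∈ {x} {y} p = let q , r = ∈-filter⁻ (λ z → ¬? (z ≟ x)) {xs = nbrs y} p in nbrs-∈ q , r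

  others-length : ∀ {x y} → Adj Γ y x → suc (length (others x y)) ≡ degree Γ y
  others-length {x} {y} a = ≤-antisym
    (filter-notAll (λ z → ¬? (z ≟ x)) (nbrs y) (Any.map (λ { refl ¬e → ¬e refl }) (∈-nbrs a)))
    (length-mono {ys = x ∷ others x y} (λ z → z) (nbrs-unique y) (λ e → e) split)
    where
    split : ∀ {z} → z ∈ nbrs y → z ∈ x ∷ others x y
    split {z} p with z ≟ x
    ... | yes e  = here e
    ... | no z≢x = there (∈-others (nbrs-∈ p) z≢x)

  record Enumeration (l : ℕ) (x y : V) : Set where
    field
      ν          : Fin l → V
      ν-inj      : ∀ {i j} → ν i ≡ ν j → i ≡ j
      ν-adj      : ∀ i → Adj Γ y (ν i)
      ν-≢        : ∀ i → ν i ≢ x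
      ν-complete : ∀ {z} → Adj Γ y z → z ≢ x → ∃[ i ] ν i ≡ z

  enumeration : ∀ {x y} → Adj Γ y x → Enumeration (length (others x y)) x y
  enumeration {x} {y} a = record
    { ν = lookup (others x y)
    ; ν-inj = lookup-injective (others-unique x y)
    ; ν-adj = λ i → proj₁ (others-∈ (∈-lookup i))
    ; ν-≢ = λ i → proj₂ (others-∈ (∈-lookup {xs = others x y} i))
    ; ν-complete = λ b z≢x → let p = ∈-others b z≢x in index p , sym (lookup-index p) }

  enumeration-of-size : ∀ {x y l} → degree Γ y ≡ suc l → Adj Γ y x → Enumeration l x y
  enumeration-of-size {x} {y} {l} e a = subst (λ k → Enumeration k x y) (ℕ-suc-injective (trans (others-length a) e)) (enumeration a)

module GraphAction (Γ : Graph) {𝒢 : RawGrp} (α : Action 𝒢 (Fin (n Γ)))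
  (act-adj : ∀ g {u v} → Adj Γ u v → Adj Γ (Action.act α g u) (Action.act α g v)) where
  open Neighbours Γ public
  open ActionProps α public

  degree-≤ : ∀ g v → degree Γ v ≤ degree Γ (act g v)
  degree-≤ g v = length-mono (act g) (nbrs-unique v) (act-inj g) (λ p → ∈-nbrs (act-adj g (nbrs-∈ p)))

  adj-fix : ∀ g {y z} → act g y ≡ y → Adj Γ y z → Adj Γ y (act g z)
  adj-fix g {y} {z} e a = subst (λ w → Adj Γ w (act g z)) e (act-adj g a)

  FixN : E → V → Set
  FixN g y = ∀ z → Adj Γ y z → act g z ≡ z

  FixN? : ∀ g y → Dec (FixN g y)
  FixN? g y = all? (λ z → Adj? y z →-dec (act g z ≟ z))

  FixN-≈ : ∀ {g h y} → g ≈ h → FixN g y → FixN h y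
  FixN-≈ e f z a = trans (sym (e z)) (f z a)

  adj-pull : ∀ g {y z} → Adj Γ (act g y) z → Adj Γ y (act (g ⁻¹) z)
  adj-pull g {y} {z} a = subst (λ w → Adj Γ w (act (g ⁻¹) z)) (act-⁻¹ˡ g y) (act-adj (g ⁻¹) a)

  FixN-conj-pow : ∀ g {h y} k → FixN (pow h k) y → FixN (pow (conj g h) k) (act g y)
  FixN-conj-pow g {h} {y} k f z a = trans (cong (act (pow (conj g h) k)) (sym (act-⁻¹ʳ g z)))
    (trans (pow-conj g h k _) (trans (cong (act g) (f _ (adj-pull g a))) (act-⁻¹ʳ g z)))

  FixN-conj : ∀ g {h y} → FixN h y → FixN (conj g h) (act g y)
  FixN-conj g {h} {y} f z a = trans (cong (act (conj g h)) (sym (act-⁻¹ʳ g z)))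
    (trans (conj-act g h _) (trans (cong (act g) (f _ (adj-pull g a))) (act-⁻¹ʳ g z)))

  fix-conj : ∀ g h {x} → act h x ≡ x → act (conj g h) (act g x) ≡ act g x
  fix-conj g h e = trans (conj-act g h _) (cong (act g) e)

  mono-pow : ∀ p g {a b x} → a ≤ b → act (pow g (p ^ a)) x ≡ x → act (pow g (p ^ b)) x ≡ x
  mono-pow p g {a} {b} {x} a≤b e with o , refl ← m≤n⇒∃[o]m+o≡n a≤b =
    trans (cong (λ N → act (pow g N) x) (trans (^-distribˡ-+-* p a o) (*-comm (p ^ a) (p ^ o)))) (fix-mul g (p ^ a) (p ^ o) e)

  -- Walking away from a fixed arc, each further step costs one p-th power.
  module Grow (connected : Connected Γ) (p : ℕ) (P : E → V → V → Set)
    (P-fix  : ∀ {g x y} → P g x y → act g y ≡ y)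
    (P-step : ∀ {g x y z} → Adj Γ x y → Adj Γ y z → P g x y → P (pow g p) y z) where

    along : ∀ {g x y v} → Adj Γ x y → P g x y → Reach Γ y v → ∃[ J ] act (pow g (p ^ J)) v ≡ v
    along {g} a s here = 0 , fix-pow g 1 (P-fix s)
    along {g} {v = v} a s (step b r) with J , e ← along b (P-step a b s) r =
      suc J , trans (cong (λ N → act (pow g N) v) (*-comm p (p ^ J))) (trans (sym (pow-* g p (p ^ J) v)) e)

    grow : ∀ {g x y} → Adj Γ x y → P g x y → ∃[ J ] Trivial (pow g (p ^ J))
    grow {g} {x} {y} a s = bound-all {P = λ v J → act (pow g (p ^ J)) v ≡ v} (λ v → mono-pow p g) (λ v → along a s (connected y v))

  -- Besides `x` there are at most two neighbours, so two of `z`, `act g z`, `act g (act g z)`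
  -- coincide; by injectivity every coincidence makes the square fix `z`.
  square-fixes-neighbours : ∀ {x y} → Adj Γ y x → length (others x y) ≤ 2 →
                    ∀ {g} → act g x ≡ x → act g y ≡ y → FixN (pow g 2) y
  square-fixes-neighbours {x} {y} a l≤2 {g} gx gy z b with z ≟ x
  ... | yes refl = fix-pow g 2 gx
  ... | no z≢x = collide (pigeonhole (s≤s l≤2) (λ i → proj₁ (idx i)))
    where
    open Enumeration (enumeration a)
    orbit : Fin 3 → V
    orbit zero             = z
    orbit (suc zero)       = act g z
    orbit (suc (suc zero)) = act g (act g z)
    step≢ : ∀ {w} → w ≢ x → act g w ≢ x
    step≢ ne e = ne (act-inj g (trans e (sym gx)))
    idx : ∀ i → ∃[ j ] ν j ≡ orbit i
    idx zero             = ν-complete b z≢x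
    idx (suc zero)       = ν-complete (adj-fix g gy b) (step≢ z≢x)
    idx (suc (suc zero)) = ν-complete (adj-fix g gy (adj-fix g gy b)) (step≢ (step≢ z≢x))
    same : ∀ i j → proj₁ (idx i) ≡ proj₁ (idx j) → orbit i ≡ orbit j
    same i j e = trans (sym (proj₂ (idx i))) (trans (cong ν e) (proj₂ (idx j)))
    fixed : act g z ≡ z → act (pow g 2) z ≡ z
    fixed = fix-pow g 2
    collide : ∃[ i ] ∃[ j ] (toℕ i < toℕ j × proj₁ (idx i) ≡ proj₁ (idx j)) → act (pow g 2) z ≡ z
    collide (zero , zero , () , _)
    collide (zero , suc zero , _ , e) = fixed (sym (same zero (suc zero) e))
    collide (zero , suc (suc zero) , _ , e) = trans (pow2 g z) (sym (same zero (suc (suc zero)) e))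
    collide (suc zero , zero , () , _)
    collide (suc zero , suc zero , s≤s () , _)
    collide (suc zero , suc (suc zero) , _ , e) = fixed (act-inj g (sym (same (suc zero) (suc (suc zero)) e)))
    collide (suc (suc zero) , zero , () , _)
    collide (suc (suc zero) , suc zero , s≤s () , _)
    collide (suc (suc zero) , suc (suc zero) , s≤s (s≤s ()) , _)

-- The symmetric group of degree 3.

S₃ : Set
S₃ = Fin 6

-- The permutations in lexicographic order of their values: `0F` is the identity, `3F` and `4F` are
-- the 3-cycles. Numbering them lets facts about the group be decided by exhaustion.
ap : S₃ → Fin 3 → Fin 3
ap 0F 0F = 0F
ap 0F 1F = 1F
ap 0F 2F = 2F
ap 1F 0F = 0F
ap 1F 1F = 2F
ap 1F 2F = 1F
ap 2F 0F = 1F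
ap 2F 1F = 0F
ap 2F 2F = 2F
ap 3F 0F = 1F
ap 3F 1F = 2F
ap 3F 2F = 0F
ap 4F 0F = 2F
ap 4F 1F = 0F
ap 4F 2F = 1F
ap 5F 0F = 2F
ap 5F 1F = 1F
ap 5F 2F = 0F

inv₃ : S₃ → S₃
inv₃ 0F = 0F
inv₃ 1F = 1F
inv₃ 2F = 2F
inv₃ 3F = 4F
inv₃ 4F = 3F
inv₃ 5F = 5F

ap-inv : ∀ s i → ap s (ap (inv₃ s) i) ≡ i
ap-inv = toWitness {a? = all? λ s → all? λ i → ap s (ap (inv₃ s) i) ≟ i} tt

to-S₃ : ∀ a b c → a ≢ b → b ≢ c → c ≢ a → ∃[ s ] (ap s 0F ≡ a × ap s 1F ≡ b × ap s 2F ≡ c)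
to-S₃ 0F 0F _ n _ _ = ⊥-elim (n refl)
to-S₃ 0F 1F 0F _ _ n = ⊥-elim (n refl)
to-S₃ 0F 1F 1F _ n _ = ⊥-elim (n refl)
to-S₃ 0F 1F 2F _ _ _ = 0F , refl , refl , refl
to-S₃ 0F 2F 0F _ _ n = ⊥-elim (n refl)
to-S₃ 0F 2F 1F _ _ _ = 1F , refl , refl , refl
to-S₃ 0F 2F 2F _ n _ = ⊥-elim (n refl)
to-S₃ 1F 0F 0F _ n _ = ⊥-elim (n refl)
to-S₃ 1F 0F 1F _ _ n = ⊥-elim (n refl)
to-S₃ 1F 0F 2F _ _ _ = 2F , refl , refl , refl
to-S₃ 1F 1F _ n _ _ = ⊥-elim (n refl)
to-S₃ 1F 2F 0F _ _ _ = 3F , refl , refl , refl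
to-S₃ 1F 2F 1F _ _ n = ⊥-elim (n refl)
to-S₃ 1F 2F 2F _ n _ = ⊥-elim (n refl)
to-S₃ 2F 0F 0F _ n _ = ⊥-elim (n refl)
to-S₃ 2F 0F 1F _ _ _ = 4F , refl , refl , refl
to-S₃ 2F 0F 2F _ _ n = ⊥-elim (n refl)
to-S₃ 2F 1F 0F _ _ _ = 5F , refl , refl , refl
to-S₃ 2F 1F 1F _ n _ = ⊥-elim (n refl)
to-S₃ 2F 1F 2F _ _ n = ⊥-elim (n refl)
to-S₃ 2F 2F _ n _ _ = ⊥-elim (n refl)

classify : ∀ (f : Fin 3 → Fin 3) → (∀ {i j} → f i ≡ f j → i ≡ j) → ∃[ s ] (∀ i → ap s i ≡ f i)
classify f inj = let s , p , q , r = to-S₃ (f 0F) (f 1F) (f 2F)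
                       (λ e → case inj e of λ ()) (λ e → case inj e of λ ()) (λ e → case inj e of λ ())
                 in s , λ { 0F → p ; 1F → q ; 2F → r }

Id? : ∀ (f : Fin 3 → Fin 3) → Dec (∀ i → f i ≡ i)
Id? f = all? λ i → f i ≟ i

infixr 9 _∘_
_∘_ : (Fin 3 → Fin 3) → (Fin 3 → Fin 3) → Fin 3 → Fin 3
(f ∘ g) i = f (g i)

-- The trailing identity mirrors the `ε` that ends `pow`, so that `rep-sq` and `rep-cube` can follow
-- its recursion.
sq cube : (Fin 3 → Fin 3) → Fin 3 → Fin 3
sq f   = f ∘ f ∘ λ i → i
cube f = f ∘ f ∘ f ∘ λ i → i

Id : (Fin 3 → Fin 3) → Set
Id f = ∀ i → f i ≡ i

S₃-exponent : ∀ s → Id (sq (ap s)) ⊎ Id (cube (ap s))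
S₃-exponent = toWitness {a? = all? λ s → Id? (sq (ap s)) ⊎-dec Id? (cube (ap s))} tt

-- In degree 3 a trivial cube characterises the even permutations, so this is closure of the
-- alternating group.
S₃-even-∙ : ∀ s t → Id (cube (ap s)) → Id (cube (ap t)) → Id (cube (ap s ∘ ap t))
S₃-even-∙ = toWitness {a? = all? λ s → all? λ t → Id? (cube (ap s)) →-dec (Id? (cube (ap t)) →-dec Id? (cube (ap s ∘ ap t)))} tt

S₃-comm : ∀ s t → Id (cube (((ap s ∘ ap t) ∘ ap (inv₃ s)) ∘ ap (inv₃ t)))
S₃-comm = toWitness {a? = all? λ s → all? λ t → Id? (cube (((ap s ∘ ap t) ∘ ap (inv₃ s)) ∘ ap (inv₃ t)))} tt

-- If `c` is a 3-cycle and `b` a transposition, then `b` and its conjugate by `c` are different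
-- transpositions, and their product is a 3-cycle, whose square is not trivial.
S₃-no-normal-involution : ∀ b c → Id (sq (ap b)) → Id (sq (ap b ∘ ((ap c ∘ ap b) ∘ ap (inv₃ c)))) → Id (sq (ap c)) ⊎ Id (ap b)
S₃-no-normal-involution = toWitness {a? = all? λ b → all? λ c → Id? (sq (ap b)) →-dec
  (Id? (sq (ap b ∘ ((ap c ∘ ap b) ∘ ap (inv₃ c)))) →-dec (Id? (sq (ap c)) ⊎-dec Id? (ap b)))} tt

S₃-transitive : ∀ q → Id (cube (ap q)) → Id (ap q) ⊎ (∀ i j → i ≡ j ⊎ (ap q i ≡ j ⊎ sq (ap q) i ≡ j))
S₃-transitive = toWitness {a? = all? λ q → Id? (cube (ap q)) →-dec (Id? (ap q) ⊎-dec
  (all? λ i → all? λ j → (i ≟ j) ⊎-dec ((ap q i ≟ j) ⊎-dec (sq (ap q) i ≟ j))))} tt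

S₃-sq-even : ∀ s → Id (cube (sq (ap s)))
S₃-sq-even = toWitness {a? = all? λ s → Id? (cube (sq (ap s)))} tt

-- The quotient `j` is kept because `fix-mul` removes explicit multiples of an exponent.
2^k-mod-3 : ∀ k → ∃[ j ] (2 ^ k ≡ 1 + j * 3 ⊎ 2 ^ k ≡ 2 + j * 3)
2^k-mod-3 zero = 0 , inj₁ refl
2^k-mod-3 (suc k) with 2^k-mod-3 k
... | j , inj₁ e = 2 * j , inj₂ (trans (cong (2 *_) e)
  (solve 1 (λ j → con 2 :* (con 1 :+ j :* con 3) := con 2 :+ (con 2 :* j) :* con 3) refl j))
  where open +-*-Solver
... | j , inj₂ e = 1 + 2 * j , inj₁ (trans (cong (2 *_) e)
  (solve 1 (λ j → con 2 :* (con 2 :+ j :* con 3) := con 1 :+ (con 1 :+ con 2 :* j) :* con 3) refl j))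
  where open +-*-Solver

3^k-mod-2 : ∀ k → ∃[ j ] 3 ^ k ≡ 1 + j * 2
3^k-mod-2 zero = 0 , refl
3^k-mod-2 (suc k) with j , e ← 3^k-mod-2 k =
  1 + 3 * j , trans (cong (3 *_) e) (solve 1 (λ j → con 3 :* (con 1 :+ j :* con 2) := con 1 :+ (con 1 :+ con 3 :* j) :* con 2) refl j)
  where open +-*-Solver

p^k≡suc : ∀ p k → ∃[ N ] suc p ^ k ≡ suc N
p^k≡suc p zero = 0 , refl
p^k≡suc p (suc k) with N , e ← p^k≡suc p k = _ , cong (suc p *_) e

-- Arc stabilisers acting on three neighbours.

module LocalThree (Γ : Graph) {𝒢 : RawGrp} (α : Action 𝒢 (Fin (n Γ)))
  (act-adj : ∀ g {u v} → Adj Γ u v → Adj Γ (Action.act α g u) (Action.act α g v))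
  (three : ∀ {x y} → Adj Γ y x → Neighbours.Enumeration Γ 3 x y) where
  open GraphAction Γ α act-adj public

  module At {x y : V} (a : Adj Γ y x) where
    open Enumeration (three a) public

    -- `f` is a function rather than a code in `S₃`, so that composites need no multiplication
    -- table.
    Rep : E → (Fin 3 → Fin 3) → Set
    Rep g f = ∀ i → act g (ν i) ≡ ν (f i)

    rep-ε : Rep ε (λ i → i)
    rep-ε i = act-ε (ν i)

    rep-∙ : ∀ {g h f k} → Rep g f → Rep h k → Rep (g ∙ h) (f ∘ k)
    rep-∙ {g} {h} {f} {k} p q i = trans (act-∙ g h _) (trans (cong (act g) (q i)) (p (k i)))

    rep-sq : ∀ {g f} → Rep g f → Rep (pow g 2) (sq f)
    rep-sq p = rep-∙ p (rep-∙ p rep-ε)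

    rep-cube : ∀ {g f} → Rep g f → Rep (pow g 3) (cube f)
    rep-cube p = rep-∙ p (rep-∙ p (rep-∙ p rep-ε))

    rep-⁻¹ : ∀ {g s} → Rep g (ap s) → Rep (g ⁻¹) (ap (inv₃ s))
    rep-⁻¹ {g} {s} p i = act-⁻¹ g (trans (p (ap (inv₃ s) i)) (cong ν (ap-inv s i)))

    rep : ∀ {g} → act g x ≡ x → act g y ≡ y → ∃[ s ] Rep g (ap s)
    rep {g} gx gy =
      let s , e = classify (λ i → proj₁ (image i)) (λ {i} {j} e → ν-inj (act-inj g
                    (trans (sym (proj₂ (image i))) (trans (cong ν e) (proj₂ (image j))))))
      in s , λ i → trans (sym (proj₂ (image i))) (cong ν (sym (e i)))
      where
      image : ∀ i → ∃[ j ] ν j ≡ act g (ν i)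
      image i = ν-complete (adj-fix g gy (ν-adj i)) (λ e → ν-≢ i (act-inj g (trans e (sym gx))))

    id⇒FixN : ∀ {g f} → act g x ≡ x → Rep g f → Id f → FixN g y
    id⇒FixN gx p e z b with z ≟ x
    ... | yes refl = gx
    ... | no z≢x with i , refl ← ν-complete b z≢x = trans (p i) (cong ν (e i))

    FixN⇒id : ∀ {g f} → Rep g f → FixN g y → Id f
    FixN⇒id p e i = ν-inj (trans (sym (p i)) (e (ν i) (ν-adj i)))

  module _ {x y : V} (a : Adj Γ y x) where
    open At a

    exponent : ∀ {g} → act g x ≡ x → act g y ≡ y → FixN (pow g 2) y ⊎ FixN (pow g 3) y
    exponent {g} gx gy with s , r ← rep gx gy with S₃-exponent s
    ... | inj₁ e = inj₁ (id⇒FixN (fix-pow g 2 gx) (rep-sq r) e)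
    ... | inj₂ e = inj₂ (id⇒FixN (fix-pow g 3 gx) (rep-cube r) e)

    even-∙ : ∀ {g h} → act g x ≡ x → act g y ≡ y → act h x ≡ x → act h y ≡ y →
             FixN (pow g 3) y → FixN (pow h 3) y → FixN (pow (g ∙ h) 3) y
    even-∙ {g} {h} gx gy hx hy ge he =
      let s , r = rep gx gy
          t , q = rep hx hy
      in id⇒FixN (fix-pow (g ∙ h) 3 (fix-∙ g h gx hx)) (rep-cube (rep-∙ r q))
           (S₃-even-∙ s t (FixN⇒id (rep-cube r) ge) (FixN⇒id (rep-cube q) he))

    comm-even : ∀ {g h} → act g x ≡ x → act g y ≡ y → act h x ≡ x → act h y ≡ y → FixN (pow (comm g h) 3) y
    comm-even {g} {h} gx gy hx hy =
      let s , r = rep gx gy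
          t , q = rep hx hy
      in id⇒FixN (fix-pow (comm g h) 3 (fix-∙ (conj g h) (h ⁻¹) (fix-∙ (g ∙ h) (g ⁻¹) (fix-∙ g h gx hx) (act-⁻¹ g gx)) (act-⁻¹ h hx)))
           (rep-cube (rep-∙ (rep-∙ (rep-∙ r q) (rep-⁻¹ {s = s} r)) (rep-⁻¹ {s = t} q))) (S₃-comm s t)

    square-even : ∀ {g} → act g x ≡ x → act g y ≡ y → FixN (pow (pow g 2) 3) y
    square-even {g} gx gy = let s , r = rep gx gy in
      id⇒FixN (fix-pow (pow g 2) 3 (fix-pow g 2 gx)) (rep-cube (rep-sq r)) (S₃-sq-even s)

    no-normal-involution : ∀ {b c} → act b x ≡ x → act b y ≡ y → act c x ≡ x → act c y ≡ y →
      FixN (pow b 2) y → FixN (pow (b ∙ conj c b) 2) y → ¬ FixN (pow c 2) y → FixN b y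
    no-normal-involution {b} {c} bx by cx cy b² bc² c² =
      let s , r = rep bx by
          t , q = rep cx cy
      in [ (λ e → ⊥-elim (c² (id⇒FixN (fix-pow c 2 cx) (rep-sq q) e))) , id⇒FixN bx r ]′
         (S₃-no-normal-involution s t (FixN⇒id (rep-sq r) b²)
           (FixN⇒id (rep-sq (rep-∙ r (rep-∙ (rep-∙ q r) (rep-⁻¹ {s = t} q)))) bc²))

    transitive : ∀ {q} → act q x ≡ x → act q y ≡ y → FixN (pow q 3) y → ¬ FixN q y →
      ∀ {z w} → Adj Γ y z → z ≢ x → Adj Γ y w → w ≢ x → z ≢ w → act q z ≡ w ⊎ act (pow q 2) z ≡ w
    transitive {q} qx qy q³ q≢ bz z≢x bw w≢x z≢w
      with s , r ← rep qx qy
      with S₃-transitive s (FixN⇒id (rep-cube r) q³)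
    ... | inj₁ e = ⊥-elim (q≢ (id⇒FixN qx r e))
    ... | inj₂ tr with i , refl ← ν-complete bz z≢x | j , refl ← ν-complete bw w≢x with tr i j
    ...   | inj₁ refl = ⊥-elim (z≢w refl)
    ...   | inj₂ (inj₁ e) = inj₁ (trans (r i) (cong ν e))
    ...   | inj₂ (inj₂ e) = inj₂ (trans (rep-sq r i) (cong ν e))

    third : ∀ w → ∃[ z ] (Adj Γ y z × z ≢ x × z ≢ w)
    third w with ν 0F ≟ w
    ... | no  e  = ν 0F , ν-adj 0F , ν-≢ 0F , e
    ... | yes e  = ν 1F , ν-adj 1F , ν-≢ 1F , λ e′ → case ν-inj (trans e′ (sym e)) of λ ()

    -- If it is the cube of `g` that fixes the neighbours, `2 ^ k` is 1 or 2 modulo 3, and the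
    -- trivial power reduces to `g` or its square.
    2-element : ∀ {g} → act g x ≡ x → act g y ≡ y → PElement 2 g → FixN (pow g 2) y
    2-element {g} gx gy (k , t) with exponent gx gy
    ... | inj₁ e = e
    ... | inj₂ e with 2^k-mod-3 k
    ...   | j , inj₁ eq = λ z b → fix-pow g 2 (begin
        act g z                       ≡⟨ pow1 g z ⟨
        act (pow g 1) z               ≡⟨ cong (act (pow g 1)) (fix-mul g 3 j (e z b)) ⟨
        act (pow g 1) (act (pow g (j * 3)) z) ≡⟨ pow-+ g 1 (j * 3) z ⟨
        act (pow g (1 + j * 3)) z     ≡⟨ cong (λ N → act (pow g N) z) eq ⟨
        act (pow g (2 ^ k)) z         ≡⟨ t z ⟩
        z                             ∎)
      where open ≡-Reasoning
    ...   | j , inj₂ eq = λ z b → begin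
        act (pow g 2) z               ≡⟨ cong (act (pow g 2)) (fix-mul g 3 j (e z b)) ⟨
        act (pow g 2) (act (pow g (j * 3)) z) ≡⟨ pow-+ g 2 (j * 3) z ⟨
        act (pow g (2 + j * 3)) z     ≡⟨ cong (λ N → act (pow g N) z) eq ⟨
        act (pow g (2 ^ k)) z         ≡⟨ t z ⟩
        z                             ∎
      where open ≡-Reasoning

    3-element : ∀ {g} → act g x ≡ x → act g y ≡ y → PElement 3 g → FixN (pow g 3) y
    3-element {g} gx gy (k , t) with exponent gx gy
    ... | inj₂ e = e
    ... | inj₁ e with j , eq ← 3^k-mod-2 k = λ z b → fix-pow g 3 (begin
        act g z                       ≡⟨ pow1 g z ⟨
        act (pow g 1) z               ≡⟨ cong (act (pow g 1)) (fix-mul g 2 j (e z b)) ⟨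
        act (pow g 1) (act (pow g (j * 2)) z) ≡⟨ pow-+ g 1 (j * 2) z ⟨
        act (pow g (1 + j * 2)) z     ≡⟨ cong (λ N → act (pow g N) z) eq ⟨
        act (pow g (3 ^ k)) z         ≡⟨ t z ⟩
        z                             ∎)
      where open ≡-Reasoning

-- Radicals of the kernels of vertex stabilisers.

module Radicals (Γ : Graph) {𝒢 : RawGrp} (α : Action 𝒢 (Fin (n Γ)))
  (act-adj : ∀ g {u v} → Adj Γ u v → Adj Γ (Action.act α g u) (Action.act α g v))
  (connected : Connected Γ) where
  open GraphAction Γ α act-adj

  Fix : V → E → Set
  Fix u g = act g u ≡ u

  N : V → E → Set
  N u g = act g u ≡ u × FixN g u

  Fix-closed : ∀ u → Closed (Fix u)
  Fix-closed u = record { has-ε = act-ε u ; has-∙ = λ {g} {h} → fix-∙ g h ; has-⁻¹ = λ {g} → act-⁻¹ g }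

  N-closed : ∀ u → Closed (N u)
  N-closed u = record
    { has-ε = act-ε u , λ z _ → act-ε z
    ; has-∙ = λ {g} {h} (p , q) (p′ , q′) → fix-∙ g h p p′ , λ z a → fix-∙ g h (q z a) (q′ z a)
    ; has-⁻¹ = λ {g} (p , q) → act-⁻¹ g p , λ z a → act-⁻¹ g (q z a) }

  N-resp : ∀ {u g h} → g ≈ h → N u g → N u h
  N-resp {u} e (p , q) = trans (sym (e u)) p , FixN-≈ e q

  N-conj : ∀ {u} g {h} → N u h → N (act g u) (conj g h)
  N-conj g {h} (p , q) = fix-conj g h p , FixN-conj g q

  -- The closure is taken under the full stabiliser `Fix u`. This still describes `O_p (N u)`, which
  -- is characteristic in the normal subgroup `N u`.
  Rad : ℕ → V → E → Set
  Rad p u x = N u x × Radical (Fix-closed u) p x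

  closure-mono : ∀ {X Y : E → Set} {x y} → (∀ {g} → X g → Y g) → NormalClosure X x y → NormalClosure Y x y
  closure-mono sub (gen p)    = gen (sub p)
  closure-mono sub one        = one
  closure-mono sub (mul p q)  = mul (closure-mono sub p) (closure-mono sub q)
  closure-mono sub (resp e p) = resp e (closure-mono sub p)

  closure-≈ : ∀ {X : E → Set} {a b y} → a ≈ b → NormalClosure X b y → NormalClosure X a y
  closure-≈ e (gen {g} p)  = resp (conj-≈ g e) (gen p)
  closure-≈ e one          = one
  closure-≈ e (mul p q)    = mul (closure-≈ e p) (closure-≈ e q)
  closure-≈ e (resp e′ p)  = resp e′ (closure-≈ e p)

  closure-ε : ∀ {X : E → Set} {y} → NormalClosure X ε y → Trivial y
  closure-ε (gen {g} p)  x = trans (conj-ε g x) (act-ε x)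
  closure-ε one          x = act-ε x
  closure-ε (mul {a} {b} p q) x = fix-∙ a b (closure-ε p x) (closure-ε q x)
  closure-ε (resp e p)   x = trans (sym (e x)) (closure-ε p x)

  closure-pow : ∀ {X : E → Set} {x y} k → NormalClosure X x y → NormalClosure X x (pow y k)
  closure-pow zero    c = one
  closure-pow (suc k) c = mul c (closure-pow k c)

  -- If `h` fixes `act g u`, then `k = g⁻¹ h g` fixes `u`, and `g k = h g` turns one conjugate into
  -- the other.
  closure-transport : ∀ g {u x y} → NormalClosure (Fix (act g u)) (conj g x) y →
                      ∃[ y′ ] (NormalClosure (Fix u) x y′ × conj g y′ ≈ y)
  closure-transport g {u} {x} (gen {h} p) = conj k x , gen fix-k , λ w → begin
      act (conj g (conj k x)) w    ≡⟨ conj-conj g k x w ⟩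
      act (conj (g ∙ k) x) w       ≡⟨ conj-intro (g ∙ k) x (λ v → trans (cong (act (conj (h ∙ g) x)) (gk≈hg v))
                                        (trans (conj-act (h ∙ g) x v) (sym (gk≈hg (act x v))))) w ⟩
      act (conj (h ∙ g) x) w       ≡⟨ conj-conj h g x w ⟨
      act (conj h (conj g x)) w    ∎
    where
    open ≡-Reasoning
    k : E
    k = g ⁻¹ ∙ (h ∙ g)
    fix-k : act k u ≡ u
    fix-k = trans (act-∙ (g ⁻¹) _ u) (act-⁻¹ g (sym (trans (act-∙ h g u) p)))
    gk≈hg : g ∙ k ≈ h ∙ g
    gk≈hg v = trans (act-∙ g k v) (trans (cong (act g) (act-∙ (g ⁻¹) _ v)) (act-⁻¹ʳ g _))
  closure-transport g one = ε , one , conj-ε g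
  closure-transport g {u} {x} (mul {a} {b} p q)
    with a′ , ca , ea ← closure-transport g {u} {x} p | b′ , cb , eb ← closure-transport g {u} {x} q
    = a′ ∙ b′ , mul ca cb , λ w → trans (conj-∙ g a′ b′ w) (trans (act-∙ _ _ w)
        (trans (cong (act (conj g a′)) (eb w)) (trans (ea _) (sym (act-∙ a b w)))))
  closure-transport g {u} {x} (resp e p) with a′ , ca , ea ← closure-transport g {u} {x} p
    = a′ , ca , λ w → trans (ea w) (e w)

  Rad-transport : ∀ {p u x} g → Rad p u x → Rad p (act g u) (conj g x)
  Rad-transport {p} {u} {x} g (Nx , r) = N-conj g Nx , λ c →
    let y′ , c′ , e = closure-transport g {u} {x} c in PElement-≈ e (PElement-conj g (r c′))

  module _ (p : ℕ) (Rad-local : ∀ {u v x} → Rad p u x → Adj Γ u v → FixN x v) where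

    -- A conjugate of `x` by some `g` fixing `v` lies in the radical at `act g u`, a neighbour of
    -- `v` and hence fixed by `N v`. So its closure under `N v` consists of p-elements, and
    -- `radical-∙` extends this to products of such conjugates.
    Rad-step : ∀ {u v x} → Rad p u x → Adj Γ u v → Rad p v x
    Rad-step {u} {v} {x} R@((xu , xN) , r) a = (xN v a , Rad-local R a) , λ c → proj₂ (go c) (self (N-closed v))
      where
      go : ∀ {y} → NormalClosure (Fix v) x y → N v y × Radical (N-closed v) p y
      go (gen {g} gv) = subst (λ w → N w (conj g x)) gv (N-conj g (xN v a , Rad-local R a)) ,
        λ c → proj₂ (Rad-transport g R) (closure-mono (λ (_ , f) → f (act g u) (adj-fix g gv (Adj-sym a))) c)
      go one = Closed.has-ε (N-closed v) , λ c → 0 , λ w → trans (pow1 _ w) (closure-ε c w)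
      go (mul p q) = let Np , rp = go p ; Nq , rq = go q in
        Closed.has-∙ (N-closed v) Np Nq , radical-∙ (N-closed v) N-resp Np rp rq
      go (resp e p) = let Np , rp = go p in N-resp e Np , λ c → rp (closure-≈ e c)

    -- `Rad-step` carries membership in the radical along a walk from `u` to any vertex.
    Rad-trivial : ∀ {u x} → Rad p u x → Trivial x
    Rad-trivial {u} R v = walk R (connected u v)
      where
      walk : ∀ {w x} → Rad p w x → Reach Γ w v → act x v ≡ v
      walk ((e , _) , _) here = e
      walk R (step a r) = walk (Rad-step R a) r

-- The case of valency 4.

-- Thompson–Wielandt for valency 4: an arc stabiliser does not involve the alternating group of degree 4.
module ThompsonWielandt (Γ : Graph) {𝒢 : RawGrp} (α : Action 𝒢 (Fin (n Γ)))
  (act-adj : ∀ g {u v} → Adj Γ u v → Adj Γ (Action.act α g u) (Action.act α g v))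
  (three : ∀ {x y} → Adj Γ y x → Neighbours.Enumeration Γ 3 x y)
  (connected : Connected Γ)
  (arc-transitive : ∀ {u v u′ v′} → Adj Γ u v → Adj Γ u′ v′ → ∃[ g ] (Action.act α g u ≡ u′ × Action.act α g v ≡ v′))
  (nbr : ∀ u → ∃[ w ] Adj Γ u w)
  where
  open LocalThree Γ α act-adj three
  open Radicals Γ α act-adj connected

  module _ {u₀ v₀ : V} (uv₀ : Adj Γ u₀ v₀) {a b : E}
    (au : act a u₀ ≡ u₀) (av : act a v₀ ≡ v₀) (bu : act b u₀ ≡ u₀) (bv : act b v₀ ≡ v₀)
    (a-powers : ∀ J → ¬ Trivial (pow a (2 ^ J))) (t-powers : ∀ J → ¬ Trivial (pow (comm a b) (3 ^ J))) where

    t : E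
    t = comm a b

    -- Commutators in the symmetric group of degree 3 are even, so `t` acts evenly on the neighbours
    -- of both ends of the arc.
    t³∈N : N u₀ (pow t 3) × N v₀ (pow t 3)
    t³∈N = (fix-pow t 3 (Closed.has-comm (Fix-closed u₀) {a} {b} au bu) , comm-even uv₀ av au bv bu)
         , (fix-pow t 3 (Closed.has-comm (Fix-closed v₀) {a} {b} av bv) , comm-even (Adj-sym uv₀) au av bu bv)

    -- In the symmetric group of degree 3 a nontrivial square means a 3-cycle, here on the
    -- neighbours of `y` other than `x`.
    ThreeCycle : V → V → Set
    ThreeCycle x y = ∃[ c ] (act c x ≡ x × act c y ≡ y × ¬ FixN (pow c 2) y)

    -- Otherwise the square of an element fixing an arc also fixes all neighbours of its end, and
    -- `grow` makes some power `2 ^ J` of `a` trivial.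
    some-3-cycle : ¬ (∀ {x y} → Adj Γ x y → ¬ ThreeCycle x y)
    some-3-cycle none = let J , e = grow uv₀ (au , av) in a-powers J e
      where
      FixArc : E → V → V → Set
      FixArc g x y = act g x ≡ x × act g y ≡ y
      square : ∀ {g x y z} → Adj Γ x y → Adj Γ y z → FixArc g x y → FixArc (pow g 2) y z
      square {g} {x} {y} {z} xy yz (gx , gy) = fix-pow g 2 gy ,
        decidable-stable (FixN? (pow g 2) y) (λ n → none xy (g , gx , gy , n)) z yz
      open Grow connected 2 FixArc proj₂ square

    module _ {x₀ y₀ : V} (xy₀ : Adj Γ x₀ y₀) (C₀ : ThreeCycle x₀ y₀) where

      3-cycle : ∀ {x y} → Adj Γ x y → ThreeCycle x y
      3-cycle axy with g , refl , refl ← arc-transitive xy₀ axy = let c , cx , cy , n = C₀ in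
        conj g c , fix-conj g c cx , fix-conj g c cy , λ f → n λ z b → act-inj g
          (trans (sym (pow-conj g c 2 z)) (f (act g z) (act-adj g b)))

      -- Both `x` and the product of `x` with its conjugate by a 3-cycle `c` are 2-elements, so both
      -- have trivial square on the neighbours of `v`. That forces `x` to be trivial there.
      Rad₂-local : ∀ {u v x} → Rad 2 u x → Adj Γ u v → FixN x v
      Rad₂-local {u} {v} {x} ((xu , xN) , r) uv with c , cu , cv , n ← 3-cycle uv =
        no-normal-involution vu xu xv cu cv
          (2-element vu xu xv (r (self (Fix-closed u))))
          (2-element vu (fix-∙ x (conj c x) xu (Closed.has-conj (Fix-closed u) {c} {x} cu xu))
                        (fix-∙ x (conj c x) xv (Closed.has-conj (Fix-closed v) {c} {x} cv xv))
            (r (mul (self (Fix-closed u)) (gen cu)))) n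
        where
        vu = Adj-sym uv
        xv = xN v uv

      Rad₂-trivial : ∀ {u x} → Rad 2 u x → Trivial x
      Rad₂-trivial = Rad-trivial 2 Rad₂-local

      module _ {u v q} (uv : Adj Γ u v) (Q₀ : Rad 3 u q) (q≢ : ¬ FixN q v) where

        3-radical-element : ∀ {z y} → Adj Γ z y → ∃[ q′ ] (Rad 3 z q′ × ¬ FixN q′ y)
        3-radical-element azy with g , refl , refl ← arc-transitive uv azy =
          conj g q , Rad-transport g Q₀ , λ f → q≢ λ z b → act-inj g (trans (sym (conj-act g q z)) (f (act g z) (act-adj g b)))

        -- s = [s, r] (r s r⁻¹), and the commutator lies in a normal 3-subgroup.
        move-even : ∀ {z y x w s q r} → Adj Γ z y → Adj Γ y w → N y s → Radical (Fix-closed z) 3 q →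
          NormalClosure (Fix z) q r → act r y ≡ y → act r x ≡ w →
          FixN (pow s 3) x → FixN (pow s 3) w
        move-even {z} {y} {x} {w} {s} {q} {r} zy yw (sy , sN) rad cr ry refl even =
          FixN-≈ (pow-cong s≈ 3) (even-∙ {x = y} (Adj-sym yw) {comm s r} {conj r s} κy (κN w yw)
            (Closed.has-conj (Fix-closed y) {r} {s} ry sy) (fix-conj r s (sN x xy))
            (3-element (Adj-sym yw) κy (κN w yw) (rad cκ)) (FixN-conj-pow r 3 even))
          where
          xy : Adj Γ y x
          xy = subst (Adj Γ y) (act-⁻¹ˡ r x) (adj-fix (r ⁻¹) (act-⁻¹ r ry) yw)
          κy : act (comm s r) y ≡ y
          κy = Closed.has-comm (Fix-closed y) {s} {r} sy ry
          κN : FixN (comm s r) y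
          κN v b = begin
            act (comm s r) v                            ≡⟨ act-∙ (conj s r) _ v ⟩
            act (conj s r) (act (r ⁻¹) v)               ≡⟨ act-∙ (s ∙ r) _ _ ⟩
            act (s ∙ r) (act (s ⁻¹) (act (r ⁻¹) v))     ≡⟨ cong (act (s ∙ r)) (act-⁻¹ s (sN _ (adj-fix (r ⁻¹) (act-⁻¹ r ry) b))) ⟩
            act (s ∙ r) (act (r ⁻¹) v)                  ≡⟨ act-∙ s r _ ⟩
            act s (act r (act (r ⁻¹) v))                ≡⟨ cong (act s) (act-⁻¹ʳ r v) ⟩
            act s v                                     ≡⟨ sN v b ⟩
            v                                           ∎
            where open ≡-Reasoning
          -- A power of `r` with exponent `3 ^ k = suc M` is trivial, so the inverse acts as
          -- `pow r M`, which the closure contains.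
          c⁻¹ : NormalClosure (Fix z) q (r ⁻¹)
          c⁻¹ with k , tr ← rad cr with M , e ← p^k≡suc 2 k =
            resp (λ v → sym (act-⁻¹ r (trans (sym (act-∙ r (pow r M) v)) (trans (cong (λ j → act (pow r j) v) (sym e)) (tr v)))))
              (closure-pow M cr)
          -- As a member of `N y`, `s` fixes the neighbour `z`; hence conjugation by `s` stays in
          -- the closure.
          cκ : NormalClosure (Fix z) q (comm s r)
          cκ = mul (closure-conj (Fix-closed z) (sN z (Adj-sym zy)) cr) c⁻¹
          s≈ : comm s r ∙ conj r s ≈ s
          s≈ v = begin
            act (comm s r ∙ conj r s) v                       ≡⟨ act-∙ (comm s r) _ v ⟩
            act (comm s r) (act (conj r s) v)                 ≡⟨ act-∙ (conj s r) _ _ ⟩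
            act (conj s r) (act (r ⁻¹) (act (conj r s) v))    ≡⟨ cong (act (conj s r)) (act-⁻¹ r (sym (trans (act-∙ (r ∙ s) _ v) (act-∙ r s _)))) ⟩
            act (conj s r) (act s (act (r ⁻¹) v))             ≡⟨ conj-act s r _ ⟩
            act s (act r (act (r ⁻¹) v))                      ≡⟨ cong (act s) (act-⁻¹ʳ r v) ⟩
            act s v                                           ∎
            where open ≡-Reasoning

        -- At a third neighbour `z` of `y`, the element of the 3-radical permutes the other three
        -- neighbours of `y` cyclically, so it or its square takes `x` to `w`, and `move-even`
        -- applies.
        evenness-constant : ∀ {y x w s} → Adj Γ y x → Adj Γ y w → x ≢ w → N y s → FixN (pow s 3) x → FixN (pow s 3) w
        evenness-constant {y} {x} {w} yx yw x≢w Ns even =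
          let z , yz , z≢x , z≢w = third yx w
              q , ((qz , qN) , rad) , q≢ = 3-radical-element (Adj-sym yz)
              qy = qN y (Adj-sym yz)
              cq = self (Fix-closed z)
          in [ (λ e → move-even (Adj-sym yz) yw Ns rad cq qy e even)
             , (λ e → move-even (Adj-sym yz) yw Ns rad (closure-pow 2 cq) (fix-pow q 2 qy) e even) ]′
             (transitive yz qz qy (3-element yz qz qy (rad cq)) q≢ yx (λ e → z≢x (sym e)) yw (λ e → z≢w (sym e)) x≢w)

        -- For `g` in both `N x` and `N y`, evenness around `x` is automatic and spreads to every
        -- neighbour of `y`. So cubing advances `g` by one arc, and `pow t 3` has 3-power order.
        3-radical-absurd : ⊥
        3-radical-absurd = let J , e = grow uv₀ t³∈N in
          t-powers (suc J) (λ v → trans (cong (λ N → act (pow t N) v) (*-comm 3 (3 ^ J))) (trans (sym (pow-* t 3 (3 ^ J) v)) (e v)))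
          where
          next : ∀ {g x y z} → Adj Γ x y → Adj Γ y z → N x g → N y g → FixN (pow g 3) z
          next {g} {x} {y} {z} xy yz (gx , gN) Ny with x ≟ z
          ... | yes refl = λ w b → fix-pow g 3 (gN w b)
          ... | no x≢z   = evenness-constant (Adj-sym xy) yz x≢z Ny (λ w b → fix-pow g 3 (gN w b))
          NArc : E → V → V → Set
          NArc g x y = N x g × N y g
          fixed : ∀ {g x y} → NArc g x y → act g y ≡ y
          fixed (_ , gy , _) = gy
          cubed : ∀ {g x y z} → Adj Γ x y → Adj Γ y z → NArc g x y → NArc (pow g 3) y z
          cubed {g} {x} {y} {z} xy yz (Nx , Ny) =
            Closed.has-pow (N-closed y) 3 Ny , (fix-pow g 3 (proj₂ Ny z yz) , next xy yz Nx Ny)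
          open Grow connected 3 NArc fixed cubed

      Rad₃-local : ∀ {u v x} → Rad 3 u x → Adj Γ u v → FixN x v
      Rad₃-local {u} {v} {x} R uv = decidable-stable (FixN? x v) (3-radical-absurd uv R)

      Rad₃-trivial : ∀ {u x} → Rad 3 u x → Trivial x
      Rad₃-trivial = Rad-trivial 3 Rad₃-local

      -- A walk of `r + 1` edges from `u`, recorded by its last arc.
      data Walk (u : V) : ℕ → V → V → Set where
        start  : ∀ {w} → Adj Γ u w → Walk u 0 u w
        extend : ∀ {r x y z} → Walk u r x y → Adj Γ y z → Walk u (suc r) y z

      Walk-adj : ∀ {u r x y} → Walk u r x y → Adj Γ x y
      Walk-adj (start a)    = a
      Walk-adj (extend _ a) = a

      Walk-act : ∀ g {u r x y} → Walk u r x y → Walk (act g u) r (act g x) (act g y)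
      Walk-act g (start a)    = start (act-adj g a)
      Walk-act g (extend p a) = extend (Walk-act g p) (act-adj g a)

      -- The pointwise stabiliser of the ball of radius r + 1 around u.
      Z : ℕ → V → E → Set
      Z r u g = ∀ {x y} → Walk u r x y → act g x ≡ x × act g y ≡ y

      Z-closed : ∀ r u → Closed (Z r u)
      Z-closed r u = record
        { has-ε  = λ _ → act-ε _ , act-ε _
        ; has-∙  = λ {g} {h} zg zh w → fix-∙ g h (proj₁ (zg w)) (proj₁ (zh w)) , fix-∙ g h (proj₂ (zg w)) (proj₂ (zh w))
        ; has-⁻¹ = λ {g} zg w → act-⁻¹ g (proj₁ (zg w)) , act-⁻¹ g (proj₂ (zg w)) }

      -- Stepping back along the last edge lengthens a walk without reaching new vertices.
      Z-pred : ∀ {r u g} → Z (suc r) u g → Z r u g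
      Z-pred z w = let p , q = z (extend w (Adj-sym (Walk-adj w))) in q , p

      Z-down : ∀ {r s u g} → r ≤ s → Z s u g → Z r u g
      Z-down {r} {zero} z≤n z = z
      Z-down {r} {suc s} r≤s z with m≤n⇒m<n∨m≡n r≤s
      ... | inj₁ (s≤s lt) = Z-down lt (Z-pred z)
      ... | inj₂ refl     = z

      Z⊆N : ∀ {r u g} → Z r u g → N u g
      Z⊆N {r} {u} z = proj₁ (Z-down {0} {r} z≤n z (start (proj₂ (nbr u)))) , λ w a → proj₂ (Z-down {0} {r} z≤n z (start a))

      pull-walk : ∀ h {r u x y} → act h u ≡ u → Walk u r x y → Walk u r (act (h ⁻¹) x) (act (h ⁻¹) y)
      pull-walk h {r} hu w = subst (λ u → Walk u r _ _) (act-⁻¹ h hu) (Walk-act (h ⁻¹) w)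

      Z-conj : ∀ {r u g h} → act h u ≡ u → Z r u g → Z r u (conj h g)
      Z-conj {g = g} {h} hu z w = let p , q = z (pull-walk h hu w) in back p , back q
        where
        back : ∀ {x} → act g (act (h ⁻¹) x) ≡ act (h ⁻¹) x → act (conj h g) x ≡ x
        back {x} e = trans (cong (act (conj h g)) (sym (act-⁻¹ʳ h x))) (trans (fix-conj h g e) (act-⁻¹ʳ h x))

      Z-resp : ∀ {r u g h} → g ≈ h → Z r u g → Z r u h
      Z-resp e z w = trans (sym (e _)) (proj₁ (z w)) , trans (sym (e _)) (proj₂ (z w))

      -- Evenness around the ends of the walks is what lets a cube pass to the next radius in
      -- `Z-cube`.
      Even : ℕ → V → E → Set
      Even r u g = ∀ {x y} → Walk u r x y → FixN (pow g 3) y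

      closure-Z : ∀ {r u g y} → Z r u g → NormalClosure (Fix u) g y → Z r u y
      closure-Z z (gen {h} p) = Z-conj {h = h} p z
      closure-Z {r} {u} z one = Closed.has-ε (Z-closed r u)
      closure-Z {r} {u} z (mul p q) = Closed.has-∙ (Z-closed r u) (closure-Z z p) (closure-Z z q)
      closure-Z z (resp e p) = Z-resp e (closure-Z z p)

      closure-Even : ∀ {r u g y} → Z r u g → Even r u g → NormalClosure (Fix u) g y → Even r u y
      closure-Even {g = g} z ev (gen {h} p) {y = y} w = subst (FixN (pow (conj h g) 3)) (act-⁻¹ʳ h y) (FixN-conj-pow h 3 (ev (pull-walk h p w)))
      closure-Even z ev one w v b = fix-pow ε 3 (act-ε v)
      closure-Even z ev (mul p q) w =
        let px , py = closure-Z z p w ; qx , qy = closure-Z z q w in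
        even-∙ (Adj-sym (Walk-adj w)) px py qx qy (closure-Even z ev p w) (closure-Even z ev q w)
      closure-Even z ev (resp e p) w = FixN-≈ (pow-cong e 3) (closure-Even z ev p w)

      Z-cube : ∀ {r u g} → Z r u g → Even r u g → Z (suc r) u (pow g 3)
      Z-cube {g = g} z ev (extend w a) = fix-pow g 3 (proj₂ (z w)) , ev w _ a

      -- For `h` in `Z r u` the square is even around all ends of walks, and so is every element of
      -- its closure; their cubes lie in `Z (suc r) u` and vanish. So the square is in the 3-radical
      -- and is trivial. Hence all of `Z r u` has exponent 2, lies in the 2-radical, and is trivial
      -- as well.
      Z-descend : ∀ r → (∀ {u g} → Z (suc r) u g → Trivial g) → ∀ {u g} → Z r u g → Trivial g
      Z-descend r triv {u} {g} z = Rad₂-trivial (Z⊆N {r} z , λ c → 1 , square (closure-Z z c))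
        where
        square : ∀ {h} → Z r u h → Trivial (pow h 2)
        square {h} zh = Rad₃-trivial (Z⊆N {r} z² , λ c → 1 , triv (Z-cube (closure-Z z² c) (closure-Even z² ev² c)))
          where
          z² : Z r u (pow h 2)
          z² = Closed.has-pow (Z-closed r u) 2 zh
          ev² : Even r u (pow h 2)
          ev² w = square-even (Adj-sym (Walk-adj w)) (proj₁ (zh w)) (proj₂ (zh w))

      Z-reaches : ∀ {u r x y v} → Walk u r x y → Reach Γ y v → ∃[ s ] (∀ {g} → Z s u g → act g v ≡ v)
      Z-reaches {r = r} w here = r , λ z → proj₂ (z w)
      Z-reaches w (step a p)   = Z-reaches (extend w a) p

      Z-eventually : ∃[ R ] (∀ u v {g} → Z R u g → act g v ≡ v)
      Z-eventually = bound-all {P = λ u R → ∀ v {g} → Z R u g → act g v ≡ v} (λ u {r} {s} r≤s h v z → h v (Z-down {r} {s} r≤s z))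
        (λ u → bound-all {P = λ v R → ∀ {g} → Z R u g → act g v ≡ v} (λ v {r} {s} r≤s h z → h (Z-down {r} {s} r≤s z))
          (λ v → Z-reaches (start (proj₂ (nbr u))) (connected _ v)))

      Z₀-trivial : ∀ R → (∀ {u g} → Z R u g → Trivial g) → ∀ {u g} → Z 0 u g → Trivial g
      Z₀-trivial zero    h = h
      Z₀-trivial (suc R) h = Z₀-trivial R (Z-descend R h)

      absurd : ⊥
      absurd with R , h ← Z-eventually =
        -- `Z 0 u₀` amounts to `N u₀`, which contains `pow t 3`.
        t-powers 1 (Z₀-trivial R (λ {u} z v → h u v z) {u₀} λ { (start a) → proj₁ (proj₁ t³∈N) , proj₂ (proj₁ t³∈N) _ a })

    contradiction : ⊥
    contradiction = some-3-cycle λ axy C → absurd axy C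

-- Lifting permutations of the matching to automorphisms.

transpose-left : ∀ {m} (i j : Fin m) → transpose i j ⟨$⟩ʳ i ≡ j
transpose-left i j rewrite dec-true (i ≟ i) refl = refl

transpose-right : ∀ {m} (i j : Fin m) → transpose i j ⟨$⟩ʳ j ≡ i
transpose-right i j with j ≟ i
... | yes refl = refl
... | no _ rewrite dec-true (j ≟ j) refl = refl

transpose-other : ∀ {m} {i j k : Fin m} → k ≢ i → k ≢ j → transpose i j ⟨$⟩ʳ k ≡ k
transpose-other {i = i} {j} {k} p q rewrite dec-false (k ≟ i) p | dec-false (k ≟ j) q = refl

module Arcs (Γ : Graph) (connected : Connected Γ) (G : Permutation′ (n Γ) → Set)
  (sub : IsAutSubgroup Γ G) (arcT : ArcTransitive Γ G) where
  open IsAutSubgroup sub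

  -- The factors are swapped because `_∘ₚ_` applies its left argument first.
  𝒢 : RawGrp
  𝒢 = record
    { E = Σ (Permutation′ (n Γ)) G
    ; _∙_ = λ (g , p) (h , q) → h ∘ₚ g , comp h g q p
    ; ε = id , hasId
    ; _⁻¹ = λ (g , p) → flip g , inv g p }

  vertices : Action 𝒢 (Fin (n Γ))
  vertices = record
    { act = λ (g , _) → g ⟨$⟩ʳ_
    ; act-∙ = λ _ _ _ → refl ; act-ε = λ _ → refl
    ; act-⁻¹ˡ = λ (g , _) _ → inverseˡ g ; act-⁻¹ʳ = λ (g , _) _ → inverseʳ g }

  adj-act : ∀ (g : RawGrp.E 𝒢) {u v} → Adj Γ u v → Adj Γ (proj₁ g ⟨$⟩ʳ u) (proj₁ g ⟨$⟩ʳ v)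
  adj-act (g , p) {u} {v} = subst T (sym (aut g p u v))

  open GraphAction Γ vertices adj-act using (degree-≤; V; Adj-sym; Enumeration; enumeration-of-size; others; others-length; ∈-others)

  arc-transitive : ∀ {u v u′ v′} → Adj Γ u v → Adj Γ u′ v′ → ∃[ g ] (Action.act vertices g u ≡ u′ × Action.act vertices g v ≡ v′)
  arc-transitive a b = let g , p , e , e′ = arcT _ _ _ _ a b in (g , p) , e , e′

  module _ {m : ℕ} (M : Matching Γ (suc m)) (permutable : Permutable Γ G M) where

    u₀ v₀ : V
    u₀ = fst M zero
    v₀ = snd M zero

    uv₀ : Adj Γ u₀ v₀
    uv₀ = isEdge M zero

    nbr : ∀ u → ∃[ w ] Adj Γ u w
    nbr u with connected u u₀
    ... | here     = v₀ , uv₀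
    ... | step a _ = _ , a

    degree-const : ∀ u v → degree Γ u ≡ degree Γ v
    degree-const u v = ≤-antisym (below u v) (below v u)
      where
      below : ∀ u v → degree Γ u ≤ degree Γ v
      below u v with g , refl , _ ← arc-transitive (proj₂ (nbr u)) (proj₂ (nbr v)) = degree-≤ g u

    same-edge : ∀ {i j} → (fst M i ≡ fst M j ⊎ fst M i ≡ snd M j) → i ≡ j
    same-edge {i} {j} e = decidable-stable (i ≟ j) λ i≢j →
      let p , q , _ = disjoint M i j i≢j in [ p , q ]′ e

    MapsEdge-∙ : ∀ {g h i j k} → MapsEdge Γ M h i j → MapsEdge Γ M g j k → MapsEdge Γ M (h ∘ₚ g) i k
    MapsEdge-∙ {g} (inj₁ (a , b)) (inj₁ (c , d)) = inj₁ (trans (cong (g ⟨$⟩ʳ_) a) c , trans (cong (g ⟨$⟩ʳ_) b) d)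
    MapsEdge-∙ {g} (inj₁ (a , b)) (inj₂ (c , d)) = inj₂ (trans (cong (g ⟨$⟩ʳ_) a) c , trans (cong (g ⟨$⟩ʳ_) b) d)
    MapsEdge-∙ {g} (inj₂ (a , b)) (inj₁ (c , d)) = inj₂ (trans (cong (g ⟨$⟩ʳ_) a) d , trans (cong (g ⟨$⟩ʳ_) b) c)
    MapsEdge-∙ {g} (inj₂ (a , b)) (inj₂ (c , d)) = inj₁ (trans (cong (g ⟨$⟩ʳ_) a) d , trans (cong (g ⟨$⟩ʳ_) b) c)

    MapsEdge-⁻¹ : ∀ {g i j} → MapsEdge Γ M g i j → MapsEdge Γ M (flip g) j i
    MapsEdge-⁻¹ {g} (inj₁ (a , b)) = inj₁ (back a , back b)
      where
      back : ∀ {x y} → g ⟨$⟩ʳ x ≡ y → g ⟨$⟩ˡ y ≡ x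
      back e = trans (cong (g ⟨$⟩ˡ_) (sym e)) (inverseˡ g)
    MapsEdge-⁻¹ {g} (inj₂ (a , b)) = inj₂ (back b , back a)
      where
      back : ∀ {x y} → g ⟨$⟩ʳ x ≡ y → g ⟨$⟩ˡ y ≡ x
      back e = trans (cong (g ⟨$⟩ˡ_) (sym e)) (inverseˡ g)

    -- Keeping `g` together with the permutation `σ` it induces gives a single group acting both on
    -- vertices and on edges of the matching.
    Inducing : Set
    Inducing = Σ[ (g , σ) ∈ Permutation′ (n Γ) × Permutation′ (suc m) ] (G g × (∀ i → MapsEdge Γ M g i (σ ⟨$⟩ʳ i)))

    ℋ : RawGrp
    ℋ = record
      { E = Inducing
      ; _∙_ = λ ((g , σ) , p , e) ((h , τ) , q , e′) → (h ∘ₚ g , τ ∘ₚ σ) , comp h g q p ,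
                λ i → MapsEdge-∙ {g} {h} (e′ i) (e (τ ⟨$⟩ʳ i))
      ; ε = (id , id) , hasId , λ i → inj₁ (refl , refl)
      ; _⁻¹ = λ ((g , σ) , p , e) → (flip g , flip σ) , inv g p ,
                λ i → MapsEdge-⁻¹ {g} (subst (MapsEdge Γ M g (σ ⟨$⟩ˡ i)) (inverseʳ σ) (e (σ ⟨$⟩ˡ i))) }

    edges : Action ℋ (Fin (suc m))
    edges = record
      { act = λ ((_ , σ) , _) → σ ⟨$⟩ʳ_
      ; act-∙ = λ _ _ _ → refl ; act-ε = λ _ → refl
      ; act-⁻¹ˡ = λ ((_ , σ) , _) _ → inverseˡ σ ; act-⁻¹ʳ = λ ((_ , σ) , _) _ → inverseʳ σ }

    verts : Action ℋ V
    verts = record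
      { act = λ ((g , _) , _) → g ⟨$⟩ʳ_
      ; act-∙ = λ _ _ _ → refl ; act-ε = λ _ → refl
      ; act-⁻¹ˡ = λ ((g , _) , _) _ → inverseˡ g ; act-⁻¹ʳ = λ ((g , _) , _) _ → inverseʳ g }

    adj-verts : ∀ (g : Inducing) {u v} → Adj Γ u v → Adj Γ (Action.act verts g u) (Action.act verts g v)
    adj-verts ((g , _) , p , _) = adj-act (g , p)

    open Cycles edges
    module 𝔼 = ActionProps edges
    module 𝕍 = GraphAction Γ verts adj-verts
    open RawGrp ℋ

    trivial-edges : ∀ (e : Inducing) → 𝕍.Trivial e → 𝔼.Trivial e
    trivial-edges ((g , σ) , _ , maps) t i with maps i
    ... | inj₁ (a , _) = sym (same-edge (inj₁ (trans (sym (t _)) a)))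
    ... | inj₂ (a , _) = sym (same-edge (inj₂ (trans (sym (t _)) a)))

    FixArc : Inducing → Set
    FixArc e = 𝕍.act e u₀ ≡ u₀ × 𝕍.act e v₀ ≡ v₀

    FixArc-closed : Closed FixArc
    FixArc-closed = record
      { has-ε = refl , refl
      ; has-∙ = λ {g} {h} (p , q) (p′ , q′) → 𝕍.fix-∙ g h p p′ , 𝕍.fix-∙ g h q q′
      ; has-⁻¹ = λ {g} (p , q) → 𝕍.act-⁻¹ g p , 𝕍.act-⁻¹ g q }

    fix-start⇒fix-edge : ∀ e → 𝕍.act e u₀ ≡ u₀ → 𝔼.act e zero ≡ zero
    fix-start⇒fix-edge ((g , σ) , _ , maps) p with maps zero
    ... | inj₁ (a , _) = sym (same-edge (inj₁ (trans (sym p) a)))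
    ... | inj₂ (a , _) = sym (same-edge (inj₂ (trans (sym p) a)))

    Cyc-cube : ∀ {g a b c} → Cyc g a b c → 𝔼.Trivial (pow g 3)
    Cyc-cube {g} {a} {b} {c} C x with x ≟ a | x ≟ b | x ≟ c
    ... | yes refl | _ | _ = trans (𝔼.pow3 g a) (trans (cong (λ z → 𝔼.act g (𝔼.act g z)) (a→b C)) (trans (cong (𝔼.act g) (b→c C)) (c→a C)))
    ... | no _ | yes refl | _ = trans (𝔼.pow3 g b) (trans (cong (λ z → 𝔼.act g (𝔼.act g z)) (b→c C)) (trans (cong (𝔼.act g) (c→a C)) (a→b C)))
    ... | no _ | no _ | yes refl = trans (𝔼.pow3 g c) (trans (cong (λ z → 𝔼.act g (𝔼.act g z)) (c→a C)) (trans (cong (𝔼.act g) (a→b C)) (b→c C)))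
    ... | no p | no q | no r = 𝔼.fix-pow g 3 (rest C p q r)

    Cyc-≈ : ∀ {g h a b c} → g 𝔼.≈ h → Cyc g a b c → Cyc h a b c
    Cyc-≈ e C = mkCyc (a≢b C) (b≢c C) (c≢a C) (trans (sym (e _)) (a→b C)) (trans (sym (e _)) (b→c C)) (trans (sym (e _)) (c→a C))
      (λ p q r → trans (sym (e _)) (rest C p q r))

    lift-cycle : ∀ {a b c} → a ≢ b → b ≢ c → c ≢ a → Σ[ e ∈ Inducing ] Cyc e a b c
    lift-cycle {a} {b} {c} ab bc ca =
      let σ = transpose a b ∘ₚ transpose a c
          g , p , maps = permutable σ
      in ((g , σ) , p , maps) , mkCyc ab bc ca
           (trans (cong (transpose a c ⟨$⟩ʳ_) (transpose-left a b)) (transpose-other (λ e → ab (sym e)) bc))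
           (trans (cong (transpose a c ⟨$⟩ʳ_) (transpose-right a b)) (transpose-left a c))
           (trans (cong (transpose a c ⟨$⟩ʳ_) (transpose-other ca (λ e → bc (sym e)))) (transpose-right a c))
           (λ xa xb xc → trans (cong (transpose a c ⟨$⟩ʳ_) (transpose-other xa xb)) (transpose-other xa xc))

    -- The fourth power of a 3-cycle is the 3-cycle itself, while its lift no longer reverses the fixed edge.
    arc-cycles : HasCycles zero FixArc
    arc-cycles {a} {b} {c} ao bo co ab bc ca =
      let e , C = lift-cycle ab bc ca
          e0 = rest C (λ q → ao (sym q)) (λ q → bo (sym q)) (λ q → co (sym q))
      in pow e 4 , fix e (subst (MapsEdge Γ M (proj₁ (proj₁ e)) zero) e0 (proj₂ (proj₂ e) zero))
         , Cyc-≈ (λ x → sym (cong (𝔼.act e) (Cyc-cube C x))) C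
      where
      fix : ∀ e → MapsEdge Γ M (proj₁ (proj₁ e)) zero zero → FixArc (pow e 4)
      fix e (inj₁ (p , q)) = 𝕍.fix-pow e 4 p , 𝕍.fix-pow e 4 q
      fix e (inj₂ (p , q)) = trans (sym (𝕍.pow-* e 2 2 u₀)) (𝕍.fix-pow (pow e 2) 2 (trans (cong (𝕍.act e) p) q))
                           , trans (sym (𝕍.pow-* e 2 2 v₀)) (𝕍.fix-pow (pow e 2) 2 (trans (cong (𝕍.act e) q) p))

    -- Modulo 3 the exponent is 1 or 2, so `a` goes to `b` or to `c`.
    Cyc-powers : ∀ {g a b c} → Cyc g a b c → ∀ J → 𝔼.act (pow g (2 ^ J)) a ≢ a
    Cyc-powers {g} {a} C J e with 2^k-mod-3 J
    ... | j , inj₁ eq = a≢b C (trans (sym e) (trans (cong (λ N → 𝔼.act (pow g N) a) eq)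
            (trans (cong (𝔼.act g) (𝔼.fix-mul g 3 j (Cyc-cube C a))) (a→b C))))
    ... | j , inj₂ eq = c≢a C (trans (sym (b→c C)) (trans (cong (𝔼.act g) (sym (a→b C)))
            (trans (cong (λ x → 𝔼.act g (𝔼.act g x)) (sym (𝔼.fix-mul g 3 j (Cyc-cube C a))))
              (trans (cong (λ N → 𝔼.act (pow g N) a) (sym eq)) e))))

    others-bound : ∀ {d} → (∀ v → degree Γ v ≤ suc d) → ∀ {x y} → Adj Γ y x → length (others x y) ≤ d
    others-bound deg a = ≤-pred (≤-trans (≤-reflexive (others-length a)) (deg _))

    -- With no further neighbours a walk from `u₀` never leaves `u₀` and `v₀`, so by connectedness a
    -- second matching edge would meet the first.
    degree-1-absurd : ∀ {i : Fin (suc m)} → i ≢ zero → (∀ v → degree Γ v ≤ 1) → ⊥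
    degree-1-absurd {i} i≢0 deg = i≢0 (same-edge (walk (inj₁ refl) (connected u₀ (fst M i))))
      where
      nonempty : ∀ {z : V} {xs} → z ∈ xs → ¬ length xs ≤ 0
      nonempty (here _)  ()
      nonempty (there _) ()
      leaf : ∀ {x y w} → Adj Γ y x → Adj Γ y w → w ≡ x
      leaf {x} {y} {w} a b = decidable-stable (w ≟ x) λ w≢x → nonempty (∈-others b w≢x) (others-bound deg a)
      walk : ∀ {x v} → x ≡ u₀ ⊎ x ≡ v₀ → Reach Γ x v → v ≡ u₀ ⊎ v ≡ v₀
      walk p here = p
      walk (inj₁ refl) (step a r) = walk (inj₂ (leaf uv₀ a)) r
      walk (inj₂ refl) (step a r) = walk (inj₁ (leaf (Adj-sym uv₀) a)) r

    -- At most two neighbours remain at each step, so squaring suffices to advance; the lift of a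
    -- 3-cycle would have 2-power order.
    degree-3-absurd : ∀ {a b c : Fin (suc m)} → a ≢ zero → b ≢ zero → c ≢ zero → a ≢ b → b ≢ c → c ≢ a →
                      (∀ v → degree Γ v ≤ 3) → ⊥
    degree-3-absurd ao bo co ab bc ca deg =
      let e , (p , q) , C = arc-cycles ao bo co ab bc ca
          J , t = 𝕍.Grow.grow connected 2 Fixed (λ {g} → fixed-end {g}) (λ {g} → square {g}) {e} uv₀ (p , q)
      in Cyc-powers C J (trivial-edges (pow e (2 ^ J)) t _)
      where
      Fixed : E → V → V → Set
      Fixed g x y = 𝕍.act g x ≡ x × 𝕍.act g y ≡ y
      square : ∀ {g x y z} → Adj Γ x y → Adj Γ y z → Fixed g x y → Fixed (pow g 2) y z
      square {g} xy yz (gx , gy) = 𝕍.fix-pow g 2 gy ,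
        𝕍.square-fixes-neighbours (Adj-sym xy) (others-bound deg (Adj-sym xy)) {g} gx gy _ yz
      fixed-end : ∀ {g x y} → Fixed g x y → 𝕍.act g y ≡ y
      fixed-end = proj₂

    -- The valency 4 argument needs an arc-transitive group, which the stabiliser of the matching
    -- need not be.
    forget : Inducing → RawGrp.E 𝒢
    forget ((g , _) , p , _) = g , p

    forget-pow : ∀ e k → RawGrp.pow 𝒢 (forget e) k ≡ forget (pow e k)
    forget-pow e zero    = refl
    forget-pow e (suc k) = cong (RawGrp._∙_ 𝒢 (forget e)) (forget-pow e k)

    -- The lifts of `(a b c)` and `(a b d)` fix an arc, and their commutator induces a double
    -- transposition, which survives every odd power, in particular every `3 ^ J`.
    degree-4-absurd : ∀ {a b c d : Fin (suc m)} → a ≢ zero → b ≢ zero → c ≢ zero → d ≢ zero →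
                      a ≢ b → b ≢ c → c ≢ a → b ≢ d → d ≢ a → c ≢ d → (∀ v → degree Γ v ≡ 4) → ⊥
    degree-4-absurd {a} {b} {c} {d} ao bo co dₒ ab bc ca bd da cd deg =
      let e , (p , q) , C = arc-cycles ao bo co ab bc ca
          f , (p′ , q′) , D = arc-cycles ao bo dₒ ab bd da
      in ThompsonWielandt.contradiction Γ vertices adj-act (λ a → enumeration-of-size (deg _) a) connected arc-transitive nbr
           uv₀ {forget e} {forget f} p q p′ q′
           (λ J t → Cyc-powers C J (trivial-edges (pow e (2 ^ J)) (transfer e (2 ^ J) t) _))
           (λ J t → swap C D J (trivial-edges (pow (comm e f) (3 ^ J)) (transfer (comm e f) (3 ^ J) t) _))
      where
      transfer : ∀ e k → ActionProps.Trivial vertices (RawGrp.pow 𝒢 (forget e) k) → 𝕍.Trivial (pow e k)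
      transfer e k t x = trans (cong (λ h → Action.act vertices h x) (sym (forget-pow e k))) (t x)
      -- (a b c)(a b d)(a b c)⁻¹(a b d)⁻¹ exchanges a and b.
      swap : ∀ {e f} → Cyc e a b c → Cyc f a b d → ∀ J → 𝔼.act (pow (comm e f) (3 ^ J)) a ≢ a
      swap {e} {f} C D J eq with j , k ← 3^k-mod-2 J =
        ab (trans (sym eq) (trans (cong (λ N → 𝔼.act (pow (comm e f) N) a) k)
          (trans (cong (𝔼.act (comm e f)) (𝔼.fix-mul (comm e f) 2 j (trans (cong (𝔼.act (comm e f)) t-a) t-b))) t-a)))
        where
        t-a : 𝔼.act (comm e f) a ≡ b
        t-a = begin
          𝔼.act e (𝔼.act f (𝔼.act (e ⁻¹) (𝔼.act (f ⁻¹) a))) ≡⟨ cong (λ x → 𝔼.act e (𝔼.act f (𝔼.act (e ⁻¹) x))) (𝔼.act-⁻¹ f (c→a D)) ⟩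
          𝔼.act e (𝔼.act f (𝔼.act (e ⁻¹) d)) ≡⟨ cong (λ x → 𝔼.act e (𝔼.act f x)) (𝔼.act-⁻¹ e (rest C da (λ x → bd (sym x)) (λ x → cd (sym x)))) ⟩
          𝔼.act e (𝔼.act f d) ≡⟨ cong (𝔼.act e) (c→a D) ⟩
          𝔼.act e a ≡⟨ a→b C ⟩
          b ∎
          where open ≡-Reasoning
        t-b : 𝔼.act (comm e f) b ≡ a
        t-b = begin
          𝔼.act e (𝔼.act f (𝔼.act (e ⁻¹) (𝔼.act (f ⁻¹) b))) ≡⟨ cong (λ x → 𝔼.act e (𝔼.act f (𝔼.act (e ⁻¹) x))) (𝔼.act-⁻¹ f (a→b D)) ⟩
          𝔼.act e (𝔼.act f (𝔼.act (e ⁻¹) a)) ≡⟨ cong (λ x → 𝔼.act e (𝔼.act f x)) (𝔼.act-⁻¹ e (c→a C)) ⟩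
          𝔼.act e (𝔼.act f c) ≡⟨ cong (𝔼.act e) (rest D ca (λ x → bc (sym x)) cd) ⟩
          𝔼.act e c ≡⟨ c→a C ⟩
          a ∎
          where open ≡-Reasoning

  -- Matchings with at least six edges.

  module _ {i : ℕ} (i≥2 : 2 ≤ i) (M : Matching Γ (4 + i)) (permutable : Permutable Γ G M)
           (deg : ∀ v → degree Γ v ≤ 3 + i) where
    private
      A : Action (ℋ M permutable) (Fin (4 + i))
      A = edges M permutable
      B : Action (ℋ M permutable) V
      B = verts M permutable
      u v : V
      u = u₀ M permutable
      v = v₀ M permutable
    open RawGrp (ℋ M permutable)
    open Cycles A
    open GraphAction Γ B (adj-verts M permutable) using (act; act-inj; fix-∙; act-⁻¹; adj-fix; enumeration)

    record Rich (K : E → Set) : Set where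
      field
        closed : Closed K
        arc    : ∀ {g} → K g → act g u ≡ u × act g v ≡ v
        cycles : HasCycles zero K

    Fixes : (E → Set) → V → Set
    Fixes K x = ∀ {g} → K g → act g x ≡ x

    -- At most `2 + i` neighbours of `y` remain besides `x`, so `AlternatingStep` preserves all
    -- 3-cycles on passing to their pointwise stabiliser.
    rich-step : ∀ {K x y} → Rich K → Adj Γ y x → Fixes K x → Fixes K y →
                Σ[ K′ ∈ (E → Set) ] (Rich K′ × (∀ {g} → K′ g → K g) × (∀ z → Adj Γ y z → Fixes K′ z))
    rich-step {K} {x} {y} R a Kx Ky = K′
      , record { closed = record { has-ε = has-ε , λ _ → refl
                                 ; has-∙ = λ {g} {h} (p , q) (p′ , q′) → has-∙ p p′ , λ j → fix-∙ g h (q j) (q′ j)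
                                 ; has-⁻¹ = λ {g} (p , q) → has-⁻¹ p , λ j → act-⁻¹ g (q j) }
               ; arc = λ (p , _) → arc p
               ; cycles = AlternatingStep.K₀-cycles A B i≥2 K closed (λ {g} k → fix-start⇒fix-edge M permutable g (proj₁ (arc k))) cycles
                            (others-bound M permutable deg a) ν ν-inj
                            (λ {g} k j → let b , e = ν-complete (adj-fix g (Ky k) (ν-adj j)) (λ e → ν-≢ j (act-inj g (trans e (sym (Kx k)))))
                                         in b , sym e) }
      , proj₁ , fixes
      where
      open Rich R
      open Closed closed
      open Enumeration (enumeration a)
      K′ : E → Set
      K′ g = K g × (∀ j → act g (ν j) ≡ ν j)
      fixes : ∀ z → Adj Γ y z → Fixes K′ z
      fixes z b (k , f) with z ≟ x
      ... | yes refl = Kx k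
      ... | no z≢x with j , refl ← ν-complete b z≢x = f j

    rich-walk : ∀ {K x y w} → Rich K → Adj Γ x y → Fixes K x → Fixes K y → Reach Γ y w →
                Σ[ K′ ∈ (E → Set) ] (Rich K′ × (∀ {g} → K′ g → K g) × Fixes K′ w)
    rich-walk {K} R a Kx Ky here = K , R , (λ k → k) , Ky
    rich-walk R a Kx Ky (step b r) =
      let K′ , R′ , sub′ , f = rich-step R (Adj-sym a) Kx Ky
          K″ , R″ , sub″ , g = rich-walk R′ b (λ k → Ky (sub′ k)) (f _ b) r
      in K″ , R″ , (λ k → sub′ (sub″ k)) , g

    -- Each vertex is added by a walk from the base arc, which every rich subgroup fixes.
    rich-list : ∀ (xs : List V) → Σ[ K ∈ (E → Set) ] (Rich K × (∀ {x} → x ∈ xs → Fixes K x))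
    rich-list [] = FixArc M permutable , record { closed = FixArc-closed M permutable ; arc = λ k → k ; cycles = arc-cycles M permutable } , λ ()
    rich-list (x ∷ xs) =
      let K , R , f = rich-list xs
          K′ , R′ , sub′ , g = rich-walk R (uv₀ M permutable) (λ k → proj₁ (Rich.arc R k)) (λ k → proj₂ (Rich.arc R k)) (connected v x)
      in K′ , R′ , λ { (here refl) → g ; (there p) k → f p (sub′ k) }

    alternating-absurd : ⊥
    alternating-absurd =
      let K , R , f = rich-list (allFin (n Γ))
          g , k , C = Rich.cycles R {1F} {2F} {3F} (λ ()) (λ ()) (λ ()) (λ ()) (λ ()) (λ ())
      in a≢b C (trans (sym (trivial-edges M permutable g (λ x → f (∈-allFin x) k) 1F)) (a→b C))

-- Connected 2-regular graphs and their automorphisms.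

module TwoRegular (Γ : Graph) (connected : Connected Γ)
  (one : ∀ {x y} → Adj Γ y x → Neighbours.Enumeration Γ 1 x y)
  {u v : Fin (n Γ)} (uv : Adj Γ u v) where
  open Neighbours Γ

  only-other : ∀ {x y z w} → Adj Γ y x → Adj Γ y z → z ≢ x → Adj Γ y w → w ≢ x → z ≡ w
  only-other a b z≢x c w≢x with ν-complete b z≢x | ν-complete c w≢x
    where open Enumeration (one a)
  ... | 0F , e | 0F , e′ = trans (sym e) e′

  Arc : Set
  Arc = Σ[ x ∈ V ] Σ[ y ∈ V ] Adj Γ x y

  next : Arc → Arc
  next (x , y , a) = y , ν 0F , ν-adj 0F
    where open Enumeration (one (Adj-sym a))

  arcs : ℕ → Arc
  arcs zero    = u , v , uv
  arcs (suc i) = next (arcs i)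

  p : ℕ → V
  p i = proj₁ (arcs i)

  -- Forbidding backtracking makes a walk in a 2-regular graph depend only on its first arc.
  record IsWalk (q : ℕ → V) : Set where
    field
      adjacent : ∀ i → Adj Γ (q i) (q (1 + i))
      onward   : ∀ i → q (2 + i) ≢ q i

  p-walk : IsWalk p
  p-walk = record { adjacent = λ i → proj₂ (proj₂ (arcs i))
                  ; onward = λ i → Enumeration.ν-≢ (one (Adj-sym (proj₂ (proj₂ (arcs i))))) 0F }
  open IsWalk p-walk

  walk-unique : ∀ {q r} → IsWalk q → IsWalk r → q 0 ≡ r 0 → q 1 ≡ r 1 → ∀ i → q i ≡ r i
  walk-unique {q} {r} wq wr e₀ e₁ i = proj₁ (go i)
    where
    module Q = IsWalk wq
    module R = IsWalk wr
    go : ∀ i → q i ≡ r i × q (1 + i) ≡ r (1 + i)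
    go zero    = e₀ , e₁
    go (suc i) with e , e′ ← go i = e′ ,
      only-other (Adj-sym (Q.adjacent i)) (Q.adjacent (1 + i)) (Q.onward i)
        (subst (λ x → Adj Γ x (r (2 + i))) (sym e′) (R.adjacent (1 + i))) (λ x → R.onward i (trans x e))

  around : ∀ i {w} → Adj Γ (p (1 + i)) w → w ≡ p i ⊎ w ≡ p (2 + i)
  around i {w} a with w ≟ p i
  ... | yes e   = inj₁ e
  ... | no w≢p = inj₂ (only-other (Adj-sym (adjacent i)) a w≢p (adjacent (1 + i)) (onward i))

  InjectiveBelow : ℕ → Set
  InjectiveBelow N = ∀ {a b} → a < N → b < N → p a ≡ p b → a ≡ b

  FirstRepeat : Set
  FirstRepeat = ∃[ N ] (InjectiveBelow N × ∃[ i ] (i < N × p i ≡ p N))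

  -- When `fuel` runs out, `N` is `suc (n Γ)` and injectivity contradicts the number of vertices.
  search : ∀ fuel N → N + fuel ≡ suc (n Γ) → InjectiveBelow N → FirstRepeat
  search zero N eq inj = ⊥-elim (<-irrefl refl (injective⇒≤ {m = suc (n Γ)} {f = λ i → p (toℕ i)}
    λ {i} {j} e → toℕ-injective (inj (below i) (below j) e)))
    where
    below : ∀ (i : Fin (suc (n Γ))) → toℕ i < N
    below i = subst (toℕ i <_) (trans (sym eq) (+-identityʳ N)) (toℕ<n i)
  search (suc fuel) N eq inj with any? (λ (i : Fin N) → p (toℕ i) ≟ p N)
  ... | yes (i , e) = N , inj , toℕ i , toℕ<n i , e
  ... | no none = search fuel (suc N) (trans (sym (+-suc N fuel)) eq) extended
    where
    new : ∀ {a} → a < N → p a ≢ p N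
    new a<N e = none (fromℕ< a<N , trans (cong p (toℕ-fromℕ< a<N)) e)
    extended : InjectiveBelow (suc N)
    extended {a} {b} (s≤s a≤N) (s≤s b≤N) e with m≤n⇒m<n∨m≡n a≤N | m≤n⇒m<n∨m≡n b≤N
    ... | inj₁ a<N | inj₁ b<N = inj a<N b<N e
    ... | inj₁ a<N | inj₂ refl = ⊥-elim (new a<N e)
    ... | inj₂ refl | inj₁ b<N = ⊥-elim (new b<N (sym e))
    ... | inj₂ refl | inj₂ refl = refl

  first-repeat : FirstRepeat
  first-repeat = search (suc (n Γ)) 0 refl λ ()

  distinct-next : ∀ i → p i ≢ p (1 + i)
  distinct-next i e = Adj-irrefl (subst (Adj Γ (p i)) (sym e) (adjacent i))

  -- If the repeated vertex were `p (suc i)`, then `p N`, being adjacent to it, would be `p i` or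
  -- `p (2 + i)`. Both contradict injectivity, up to end cases excluded by `distinct-next` and
  -- `onward`.
  returns-to-start : ∀ {N i} → InjectiveBelow (suc N) → i < suc N → p i ≡ p (suc N) → i ≡ 0
  returns-to-start {N} {zero}  inj i<N e = refl
  returns-to-start {N} {suc i} inj i<N e
    with around i {p N} (subst (λ x → Adj Γ x (p N)) (sym e) (Adj-sym (adjacent N)))
  ... | inj₁ e′ with refl ← inj ≤-refl (≤-trans (n≤1+n _) i<N) e′ = ⊥-elim (<-irrefl refl i<N)
  ... | inj₂ e′ with m≤n⇒m<n∨m≡n i<N
  ...   | inj₂ refl = ⊥-elim (distinct-next (suc i) e′)
  ...   | inj₁ i+1<N with refl ← inj ≤-refl i+1<N e′ = ⊥-elim (onward (suc i) (sym e))

  record Period : Set where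
    field
      N′        : ℕ
      injective : InjectiveBelow (suc N′)
      closes    : p (suc N′) ≡ p 0

  period : Period
  period with first-repeat
  ... | suc N , inj , i , i<N , e with refl ← returns-to-start inj i<N e = record { N′ = N ; injective = inj ; closes = sym e }

  open Period period public

  N : ℕ
  N = suc N′

  return-time : ∀ k → p (suc k) ≡ p 0 → 3 ≤ suc k
  return-time 0 e = ⊥-elim (distinct-next 0 (sym e))
  return-time 1 e = ⊥-elim (onward 0 e)
  return-time (suc (suc k)) e = s≤s (s≤s (s≤s z≤n))

  N≥3 : 3 ≤ N
  N≥3 = return-time N′ closes

  adj-last : Adj Γ (p 0) (p N′)
  adj-last = subst (λ x → Adj Γ x (p N′)) closes (Adj-sym (adjacent N′))

  last≢1 : p N′ ≢ p 1
  last≢1 e = <-irrefl (cong suc (sym (injective ≤-refl (<⇒≤ N≥3) e))) N≥3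

  -- The shifted walk is at `p 0` again, coming from `p N′`; the only way on is `p 1`, and
  -- `walk-unique` applies.
  periodic : ∀ i → p (i + N) ≡ p i
  periodic = walk-unique (record { adjacent = λ i → adjacent (i + N) ; onward = λ i → onward (i + N) }) p-walk closes
    (only-other adj-last (subst (λ x → Adj Γ x (p (1 + N))) closes (adjacent N)) (onward N′) (adjacent 0) (λ e → last≢1 (sym e)))

  periodic* : ∀ i q → p (i + q * N) ≡ p i
  periodic* i zero    = cong p (+-identityʳ i)
  periodic* i (suc q) = trans (cong p (trans (cong (i +_) (+-comm N (q * N))) (sym (+-assoc i (q * N) N))))
    (trans (periodic (i + q * N)) (periodic* i q))

  p-% : ∀ i → p i ≡ p (i % N)
  p-% i = trans (cong p (m≡m%n+[m/n]*n i N)) (periodic* (i % N) (i / N))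

  p≡⇒% : ∀ {i} j → i < N → p i ≡ p j → i ≡ j % N
  p≡⇒% {i} j i<N e = injective i<N (m%n<n j N) (trans e (p-% j))

  -- `i + N′` stands for the predecessor of `i` modulo `N`, which avoids subtraction.
  neighbours : ∀ i {w} → Adj Γ (p i) w → w ≡ p (1 + i) ⊎ w ≡ p (i + N′)
  neighbours i {w} a with around (i + N′) (subst (λ x → Adj Γ x w) (trans (sym (periodic i)) (cong p (+-suc i N′))) a)
  ... | inj₁ e = inj₂ e
  ... | inj₂ e = inj₁ (trans e (trans (cong p (cong suc (sym (+-suc i N′)))) (periodic (1 + i))))

  surjective : ∀ w → ∃[ i ] (i < N × p i ≡ w)
  surjective w = let i , e = go 0 refl (connected (p 0) w) in i % N , m%n<n i N , trans (sym (p-% i)) e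
    where
    go : ∀ {x} i → x ≡ p i → Reach Γ x w → ∃[ j ] p j ≡ w
    go i refl here = i , refl
    go i refl (step a r) with neighbours i a
    ... | inj₁ e = go (1 + i) e r
    ... | inj₂ e = go (i + N′) e r

  position : V → Fin N
  position w = let i , i<N , _ = surjective w in fromℕ< i<N

  p-position : ∀ w → p (toℕ (position w)) ≡ w
  p-position w = let i , i<N , e = surjective w in trans (cong p (toℕ-fromℕ< i<N)) e

  adj⇒succ : ∀ {i j} → i < N → j < N → Adj Γ (p i) (p j) → p j ≡ p (1 + i) ⊎ p i ≡ p (1 + j)
  adj⇒succ {i} {j} i<N j<N a with neighbours i a
  ... | inj₁ e = inj₁ e
  adj⇒succ {zero}  {j} i<N j<N a | inj₂ e with refl ← injective j<N ≤-refl e = inj₂ (sym closes)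
  adj⇒succ {suc i} {j} i<N j<N a | inj₂ e
    with refl ← injective j<N (≤-trans (n≤1+n _) i<N) (trans e (trans (cong p (sym (+-suc i N′))) (periodic i))) = inj₂ refl

  isCycle : IsCycle Γ N
  isCycle = mk↔ₛ′ position (λ i → p (toℕ i)) (λ i → toℕ-injective (injective (toℕ<n _) (toℕ<n i) (p-position _))) p-position
    , λ x y → to x y , from x y
    where
    to : ∀ x y → Adj Γ x y → CycleAdj N (position x) (position y)
    to x y a with adj⇒succ (toℕ<n (position x)) (toℕ<n (position y))
                    (subst (λ z → Adj Γ z _) (sym (p-position x)) (subst (Adj Γ x) (sym (p-position y)) a))
    ... | inj₁ e = inj₁ (p≡⇒% (suc (toℕ (position x))) (toℕ<n (position y)) e)
    ... | inj₂ e = inj₂ (p≡⇒% (suc (toℕ (position y))) (toℕ<n (position x)) e)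
    succ-adj : ∀ x y → toℕ (position y) ≡ suc (toℕ (position x)) % N → Adj Γ x y
    succ-adj x y e = subst (λ z → Adj Γ z y) (p-position x)
      (subst (Adj Γ _) (trans (p-% (suc (toℕ (position x)))) (trans (cong p (sym e)) (p-position y))) (adjacent (toℕ (position x))))
    from : ∀ x y → CycleAdj N (position x) (position y) → Adj Γ x y
    from x y (inj₁ e) = succ-adj x y e
    from x y (inj₂ e) = Adj-sym (succ-adj y x e)

  module _ (h : V → V) (h-adj : ∀ {x y} → Adj Γ x y → Adj Γ (h x) (h y)) (h-inj : ∀ {x y} → h x ≡ h y → x ≡ y) where

    hp-walk : IsWalk (λ i → h (p i))
    hp-walk = record { adjacent = λ i → h-adj (adjacent i) ; onward = λ i e → onward i (h-inj e) }

    rotation : ∀ {a} → h (p 0) ≡ p a → h (p 1) ≡ p (1 + a) → ∀ i → h (p i) ≡ p (i + a)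
    rotation {a} e e′ = walk-unique hp-walk (record { adjacent = λ i → adjacent (i + a) ; onward = λ i → onward (i + a) }) e e′

    -- The equation `i + c ≡ b` replaces `b - i`. The image walk runs downwards, since injectivity
    -- of `h` forbids it to turn back.
    reflection : ∀ {b} → h (p 0) ≡ p (1 + b) → h (p 1) ≡ p b → ∀ i c → i + c ≡ b → h (p i) ≡ p (1 + c) × h (p (1 + i)) ≡ p c
    reflection e e′ zero    c refl = e , e′
    reflection e e′ (suc i) c eq with f , f′ ← reflection e e′ i (suc c) (trans (+-suc i c) eq)
      with around c (subst (λ x → Adj Γ x (h (p (2 + i)))) f′ (h-adj (adjacent (1 + i))))
    ... | inj₁ g = f′ , g
    ... | inj₂ g = ⊥-elim (onward i (h-inj (trans g (sym f))))

    -- A reflection would be an involution on p 0; for a rotation by a, N divides 3a < 3N.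
    triple-rotation : (h (h (p 0)) ≢ p 0) → h (p 0) ≢ p 0 →
      h (h (h (p 0))) ≡ p 0 ⊎ (h (h (h (p 0))) ≡ p 1 × h (h (h (p 1))) ≡ p 0) → ∃[ k ] N ≡ 3 * k
    triple-rotation h²≢ h≢ h³ with surjective (h (p 0))
    ... | a , a<N , e with neighbours a (subst (λ x → Adj Γ x (h (p 1))) (sym e) (h-adj (adjacent 0)))
    -- Adding a period writes the image of `p 0` as `p (1 + (a + N′))`; the reflection then takes
    -- `p a` to `p N`, that is to `p 0`.
    ... | inj₂ e′ = ⊥-elim (h²≢ (trans (cong h (sym e)) (trans
            (proj₁ (reflection (trans (sym e) (trans (sym (periodic a)) (cong p (+-suc a N′)))) e′ a N′ refl)) closes)))
    ... | inj₁ e′ = divides-3a h³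
      where
      rot = rotation (sym e) e′
      h³p : ∀ i → h (h (h (p i))) ≡ p (i + 3 * a)
      h³p i = begin
        h (h (h (p i)))     ≡⟨ cong (λ x → h (h x)) (rot i) ⟩
        h (h (p (i + a)))   ≡⟨ cong h (rot (i + a)) ⟩
        h (p (i + a + a))   ≡⟨ rot (i + a + a) ⟩
        p (i + a + a + a)   ≡⟨ cong p (solve 2 (λ i a → i :+ a :+ a :+ a := i :+ con 3 :* a) refl i a) ⟩
        p (i + 3 * a)       ∎
        where
        open ≡-Reasoning
        open +-*-Solver
      a≢0 : a ≢ 0
      a≢0 refl = h≢ (sym e)
      -- Since `0 < a < N`, only `q = 1` and `q = 2` survive; in the second case
      -- `N = 3 * N ∸ 3 * a`.
      quotient : ∀ q → 3 * a ≡ q * N → ∃[ k ] N ≡ 3 * k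
      quotient 0 eq = ⊥-elim (a≢0 (m+n≡0⇒m≡0 a eq))
      quotient 1 eq = a , trans (sym (+-identityʳ N)) (sym eq)
      quotient 2 eq = N ∸ a , (begin
        N                 ≡⟨ m+n∸n≡m N (3 * a) ⟨
        N + 3 * a ∸ 3 * a ≡⟨ cong (λ x → N + x ∸ 3 * a) eq ⟩
        3 * N ∸ 3 * a     ≡⟨ *-distribˡ-∸ 3 N a ⟨
        3 * (N ∸ a)       ∎)
        where open ≡-Reasoning
      quotient (suc (suc (suc q))) eq = ⊥-elim (<-irrefl eq (<-≤-trans (*-monoʳ-< 3 a<N)
        (≤-trans (m≤m+n (3 * N) (q * N)) (≤-reflexive (solve 2 (λ N q → con 3 :* N :+ q :* N := (con 3 :+ q) :* N) refl N q)))))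
        where
        open +-*-Solver
      divides-3a : h (h (h (p 0))) ≡ p 0 ⊎ (h (h (h (p 0))) ≡ p 1 × h (h (h (p 1))) ≡ p 0) → ∃[ k ] N ≡ 3 * k
      divides-3a (inj₁ f) = quotient (3 * a / N) (trans (m≡m%n+[m/n]*n (3 * a) N)
        (cong (_+ 3 * a / N * N) (sym (p≡⇒% (3 * a) (s≤s z≤n) (sym (trans (sym (h³p 0)) f))))))
      -- Here the cube would be a rotation by 1 modulo `N`, taking `p 1` to `p 2` rather than to
      -- `p 0`.
      divides-3a (inj₂ (f , f′)) = ⊥-elim (onward 0 (begin
        p 2                              ≡⟨ periodic* 2 (3 * a / N) ⟨
        p (1 + (1 + 3 * a / N * N))      ≡⟨ cong (λ r → p (1 + (r + 3 * a / N * N))) (p≡⇒% (3 * a) (<⇒≤ N≥3) (sym (trans (sym (h³p 0)) f))) ⟩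
        p (1 + (3 * a % N + 3 * a / N * N)) ≡⟨ cong (λ x → p (1 + x)) (m≡m%n+[m/n]*n (3 * a) N) ⟨
        p (1 + 3 * a)                    ≡⟨ h³p 1 ⟨
        h (h (h (p 1)))                  ≡⟨ f′ ⟩
        p 0                              ∎))
        where open ≡-Reasoning

-- Conclusion by cases on the size of the matching.

module _ (Γ : Graph) (connected : Connected Γ) (G : Permutation′ (n Γ) → Set)
  (sub : IsAutSubgroup Γ G) (arcT : ArcTransitive Γ G) where
  open Arcs Γ connected G sub arcT

  cycle-case : (M : Matching Γ 3) → Permutable Γ G M → (∀ v → degree Γ v ≡ 2) → ∃[ k ] (2 ≤ k × IsCycle Γ (3 * k))
  cycle-case M permutable deg = k , k≥2 k (subst (4 ≤_) N≡3k 4≤N) , subst (IsCycle Γ) N≡3k isCycle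
    where
    open Neighbours Γ using (enumeration-of-size; Adj-irrefl)
    one : ∀ {x y} → Adj Γ y x → Neighbours.Enumeration Γ 1 x y
    one {x} {y} a = enumeration-of-size (deg y) a
    open TwoRegular Γ connected one (uv₀ M permutable)
    open Cycles (edges M permutable)
    open RawGrp (ℋ M permutable)
    open GraphAction Γ (verts M permutable) (adj-verts M permutable) using (act; act-inj)

    lifted : Σ[ e ∈ E ] Cyc e 0F 1F 2F
    lifted = lift-cycle M permutable (λ ()) (λ ()) (λ ())

    e : E
    e = proj₁ lifted

    C : Cyc e 0F 1F 2F
    C = proj₂ lifted

    actᵉ : E → Fin 3 → Fin 3
    actᵉ = Action.act (edges M permutable)

    e²0 : actᵉ (e ∙ e) 0F ≡ 2F
    e²0 = trans (cong (actᵉ e) (a→b C)) (b→c C)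

    e³0 : actᵉ (e ∙ (e ∙ e)) 0F ≡ 0F
    e³0 = trans (cong (actᵉ e) e²0) (c→a C)

    -- The cube of `e` fixes the edge `0F` of the matching, whose ends are `p 0` and `p 1`, but may
    -- reverse it.
    h³ : act e (act e (act e (p 0))) ≡ p 0 ⊎ (act e (act e (act e (p 0))) ≡ p 1 × act e (act e (act e (p 1))) ≡ p 0)
    h³ with subst (MapsEdge Γ M (proj₁ (proj₁ (e ∙ (e ∙ e)))) 0F) e³0 (proj₂ (proj₂ (e ∙ (e ∙ e))) 0F)
    ... | inj₁ (q , _) = inj₁ q
    ... | inj₂ q       = inj₂ q

    triple : ∃[ k ] N ≡ 3 * k
    triple = triple-rotation (act e) (adj-verts M permutable e) (act-inj e)
      (λ q → case trans (sym e²0) (fix-start⇒fix-edge M permutable (e ∙ e) q) of λ ())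
      (λ q → a≢b C (trans (sym (fix-start⇒fix-edge M permutable e q)) (a→b C))) h³

    k : ℕ
    k = proj₁ triple

    N≡3k : N ≡ 3 * k
    N≡3k = proj₂ triple

    -- The four ends of two matching edges are distinct, which excludes the triangle and yields
    -- `2 ≤ k`.
    corner : Fin 4 → Fin (n Γ)
    corner 0F = fst M 0F
    corner 1F = snd M 0F
    corner 2F = fst M 1F
    corner 3F = snd M 1F

    loop : ∀ i → fst M i ≢ snd M i
    loop i q = Adj-irrefl (subst (Adj Γ (fst M i)) (sym q) (isEdge M i))

    corner-inj : ∀ i j → corner i ≡ corner j → i ≡ j
    corner-inj i j q with disjoint M 0F 1F (λ ())
    corner-inj 0F 0F q | _ = refl
    corner-inj 0F 1F q | _ = ⊥-elim (loop 0F q)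
    corner-inj 0F 2F q | a , _ = ⊥-elim (a q)
    corner-inj 0F 3F q | _ , b , _ = ⊥-elim (b q)
    corner-inj 1F 0F q | _ = ⊥-elim (loop 0F (sym q))
    corner-inj 1F 1F q | _ = refl
    corner-inj 1F 2F q | _ , _ , c , _ = ⊥-elim (c q)
    corner-inj 1F 3F q | _ , _ , _ , d = ⊥-elim (d q)
    corner-inj 2F 0F q | a , _ = ⊥-elim (a (sym q))
    corner-inj 2F 1F q | _ , _ , c , _ = ⊥-elim (c (sym q))
    corner-inj 2F 2F q | _ = refl
    corner-inj 2F 3F q | _ = ⊥-elim (loop 1F q)
    corner-inj 3F 0F q | _ , b , _ = ⊥-elim (b (sym q))
    corner-inj 3F 1F q | _ , _ , _ , d = ⊥-elim (d (sym q))
    corner-inj 3F 2F q | _ = ⊥-elim (loop 1F (sym q))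
    corner-inj 3F 3F q | _ = refl

    4≤N : 4 ≤ N
    4≤N = injective⇒≤ {f = λ i → position (corner i)} λ {i} {j} q →
      corner-inj i j (trans (sym (p-position (corner i))) (trans (cong (λ x → p (toℕ x)) q) (p-position (corner j))))

    k≥2 : ∀ k → 4 ≤ 3 * k → 2 ≤ k
    k≥2 0 ()
    k≥2 1 (s≤s (s≤s (s≤s ())))
    k≥2 (suc (suc k)) _ = s≤s (s≤s z≤n)

  small-degree : ∀ m (M : Matching Γ m) → Permutable Γ G M → (∃[ v ] degree Γ v < m) → m ≡ 3 × ∃[ k ] (2 ≤ k × IsCycle Γ (3 * k))
  small-degree (suc m) M permutable (v , s≤s lt) = go m M permutable bound
    where
    bound : ∀ w → degree Γ w ≤ m
    bound w = ≤-trans (≤-reflexive (degree-const M permutable w v)) lt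
    exactly : ∀ {m d} (M : Matching Γ (suc m)) → Permutable Γ G M → (∀ w → degree Γ w ≤ suc d) →
              (∀ w → degree Γ w ≤ d) ⊎ (∀ w → degree Γ w ≡ suc d)
    exactly M permutable b with m≤n⇒m<n∨m≡n (b (u₀ M permutable))
    ... | inj₁ (s≤s q) = inj₁ λ w → ≤-trans (≤-reflexive (degree-const M permutable w _)) q
    ... | inj₂ q       = inj₂ λ w → trans (degree-const M permutable w _) q
    go : ∀ m (M : Matching Γ (suc m)) → Permutable Γ G M → (∀ w → degree Γ w ≤ m) → suc m ≡ 3 × ∃[ k ] (2 ≤ k × IsCycle Γ (3 * k))
    go 0 M perm b with () ← ≤-trans (≤-reflexive (Neighbours.others-length Γ (uv₀ M perm))) (b _)
    go 1 M perm b = ⊥-elim (degree-1-absurd M perm {1F} (λ ()) b)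
    go 2 M perm b with exactly M perm b
    ... | inj₁ b′ = ⊥-elim (degree-1-absurd M perm {1F} (λ ()) b′)
    ... | inj₂ d  = refl , cycle-case M perm d
    go 3 M perm b = ⊥-elim (degree-3-absurd M perm {1F} {2F} {3F} (λ ()) (λ ()) (λ ()) (λ ()) (λ ()) (λ ()) b)
    go 4 M perm b with exactly M perm b
    ... | inj₁ b′ = ⊥-elim (degree-3-absurd M perm {1F} {2F} {3F} (λ ()) (λ ()) (λ ()) (λ ()) (λ ()) (λ ()) b′)
    ... | inj₂ d  = ⊥-elim (degree-4-absurd M perm {1F} {2F} {3F} {4F} (λ ()) (λ ()) (λ ()) (λ ()) (λ ()) (λ ()) (λ ()) (λ ()) (λ ()) (λ ()) d)
    -- The matching has `4 + (2 + i)` edges, hence the shifted parameter.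
    go (suc (suc (suc (suc (suc i))))) M perm b = ⊥-elim (alternating-absurd {suc (suc i)} (s≤s (s≤s z≤n)) M perm b)

theorem1p1 : (Γ : Graph) → Connected Γ →
    (G : Permutation′ (n Γ) → Set) → IsAutSubgroup Γ G → ArcTransitive Γ G →
    (m : ℕ) → (M : Matching Γ m) → Permutable Γ G M →
    (∀ v → m ≤ degree Γ v) ⊎ (m ≡ 3 × ∃[ k ] (2 ≤ k × IsCycle Γ (3 * k)))
theorem1p1 Γ connected G sub arcT m M permutable with all? (λ v → m ≤? degree Γ v)
... | yes large = inj₁ large
... | no ¬large = let v , m≰ = ¬∀⟶∃¬ _ (λ v → m ≤ degree Γ v) (λ v → m ≤? degree Γ v) ¬large
                  in inj₂ (small-degree Γ connected G sub arcT m M permutable (v , ≰⇒> m≰))
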